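{- For nonnegative integers $k,m$ let $C_{(k,k+m,k+m,k+m)}(q,t)$ be the refined $q,t$-Catalan number defined in the context (with the stated convention when $k=0$). Define the formal power series \[ H(x,y,q,t):=\sum_{k,m\ge 0} C_{(k,k+m,k+m,k+m)}(q,t)\,x^k y^m . \] Then \[ H(x,y,q,t)=\frac{ -M}{(1-xq^6)(1-xt^6)(1-xq^3t)(1-xqt^3)(1-xq^2t^2)(1-yq^3)(1-yt^3)(1-yqt)}, \] where \begin{align*} M={}&(q^{13}t^7 + q^7t^{13} + q^{12}t^8 + q^8t^{12} + q^9t^{12} + q^{12}t^9 + q^{11}t^{11} + q^{10}t^{11}+ q^{11}t^{10} + q^9t^{11} + q^{11}t^9 + q^{10}t^{10})x^3y^2 \\ &- (q^{11}t^5 + q^5t^{11} + q^{10}t^6 + q^6t^{10} + q^8t^9 + q^9t^8 + q^7t^9 + q^9t^7 + q^8t^8 - q^7t^8 - q^8t^7 + q^7t^7)x^2y^2 \\ &-(q^7t^4 + q^4t^7 + q^6t^5 + q^5t^6)xy^2\\ &-(q^{12}t^6 + q^6t^{12} + q^8t^{11} + q^{11}t^8 + q^{10}t^8 + q^8t^{10} + q^7t^{11} + q^{11}t^7 + q^7t^{10} + q^{10}t^7 + 2q^9t^9 + q^8t^9 + q^9t^8)x^3y\\ &-(q^{10}t^3 + q^3t^{10} + q^5t^7 + q^7t^5 - q^5t^9 -q^9t^5 + q^4t^9 + q^9t^4 + q^4t^8 + q^8t^4 + q^5t^6 + q^6t^5-q^8t^6 - q^6t^8)x^2y \\ &+(qt^8+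 q^8t + qt^7 + q^7t + q^6t^3 +q^3t^6 + q^4t^5 + q^5t^4 + q^2t^5 + q^5t^2 + 2q^4t^4 + q^5t^3+ q^3t^5 +2q^3t^4 +2q^4t^3 \\ &\qquad + q^7t^2 + q^2t^7 + q^6t^2 + q^2t^6)xy \\ &-(q^2t+qt^2)y\\ &+(q^9t^6 + q^6t^9 + q^8t^7+ q^7t^8 + q^8t^8 )x^3 + (q^7t^3 + q^3t^7 - q^5t^6 - q^6t^5 + q^4t^6 + q^6t^4 + q^5t^5 + q^4t^5 + q^5t^4)x^2 \\ &-(qt^5 + q^5t + q^2t^4 + q^4t^2 + qt^4 + q^4t + q^3t^3 + q^2t^3 + q^3t^2)x - 1 . \end{align*}
   Context: Let $\vec k=(k_1,\dots,k_n)$ be a vector of positive integers and $K=k_1+\dots+k_n$. A $\vec k$-Dyck path is a lattice path from $(0,0)$ to $(K,K)$ of the form $N^{k_1}E^{a_1}N^{k_2}E^{a_2}\cdots N^{k_n}E^{a_n}$, where $N=(0,1)$, $E=(1,0)$, the $a_i$ are nonnegative integers with $a_1+\dots+a_n=K$, and the path never goes below the line $y=x$ (equivalently $a_1+\dots+a_i\le k_1+\dots+k_i$ for all $i$). The segment $N^{k_j}$ is called the $j$-th north step (of length $k_j$); consecutive north steps with an intervening $a_i=0$ are still counted as distinct north steps. The rank of a point $(x,y)$ is $y-x$. The red ranks are $r_j=\sum_{i<j}(k_i-a_i)$, the rank of the starting point of the $j$-th north step, and $\mathrm{area}(D)=r_1+\dots+r_n$. Bounce (Xin–Zhang algorithm):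 let $R$ be an initially empty diagram with columns $1,\dots,n$, column $j$ having $k_j+1$ cells (rows $1,\dots,k_j+1$). Set $i=0$, $P_0=(0,0)$. While $P_i\neq(K,K)$: (1) Let $Q_i$ be the starting point of the (unique) east step of $D$ whose starting point has the same $x$-coordinate as $P_i$; the $y$-coordinate of $P_i$ is $k_1+\dots+k_s$ and that of $Q_i$ is $k_1+\dots+k_{s+v_i}$ for some $v_i\ge 0$ (the number of north steps traversed going vertically from $P_i$ to $Q_i$). (2) Fill the next (leftmost) $v_i$ unfilled columns of $R$: a column $j$ being filled gets entries $i,i+1,\dots,i+k_j$ from top to bottom. (3) Let $h_i$ be the number of cells of $R$ (filled so far) containing the value $i+1$, and set $P_{i+1}=(x(Q_i)+h_i,\,y(Q_i))$. (4) Increase $i$ by $1$. Then $\mathrm{bounce}(D)=\sum_{i\ge 0} i\,v_i$. The refined $q,t$-Catalan number is $C_{\vec k}(q,t)=\sum_{D}q^{\mathrm{area}(D)}t^{\mathrm{bounce}(D)}$, summing over all $\vec k$-Dyck paths. Convention for zero entries appearing in the sum: $C_{(0,m,m,m)}(q,t)$ is interpreted as $C_{(m,m,m)}(q,t)$ for $m>0$ (the zero-length first north step is dropped), and $C_{(0,0,0,0)}(q,t)=1$. -}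

module Defs where

open import Data.Bool using (Bool; true; false; if_then_else_; _∧_)
open import Data.Nat using (ℕ; zero; suc; _+_; _*_; _∸_; _≡ᵇ_; _<ᵇ_; _≤ᵇ_)
open import Data.Integer as ℤ using (ℤ)
open import Data.Nat.ListAction using (sum)
open import Data.List using (List; []; _∷_; _++_; map; concatMap; length; filter; take; drop; upTo; foldr)
open import Data.Product using (_×_; _,_; proj₁; proj₂)

-- k-Dyck paths.
-- A k-vector is a list ks = (k₁,…,kₙ) of positive integers; a k-Dyck
-- path N^{k₁}E^{a₁}⋯N^{kₙ}E^{aₙ} is encoded by its list (a₁,…,aₙ).

-- dyckGen r ks : all lists (aⱼ,…) continuing a path whose current rank
-- (= y - x at the start of the next north step) is r, staying weakly
-- above y = x (a₁+⋯+aᵢ ≤ k₁+⋯+kᵢ) and ending at (K,K).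
dyckGen : ℕ → List ℕ → List (List ℕ)
dyckGen r []       = if r ≡ᵇ 0 then ([] ∷ []) else []
dyckGen r (k ∷ ks) =
  concatMap (λ a → map (a ∷_) (dyckGen ((r + k) ∸ a) ks)) (upTo (suc (r + k)))

dyckPaths : List ℕ → List (List ℕ)
dyckPaths ks = dyckGen 0 ks

-- area = sum of red ranks r_j = Σ_{i<j} (kᵢ - aᵢ)

areaFrom : ℕ → List ℕ → List ℕ → ℕ
areaFrom r (k ∷ ks) (a ∷ as) = r + areaFrom ((r + k) ∸ a) ks as
areaFrom r _        _        = 0

area : List ℕ → List ℕ → ℕ
area ks as = areaFrom 0 ks as

-- bounce (Xin–Zhang algorithm)

prefixSums : List ℕ → List ℕ
prefixSums = go 0
  where
  go : ℕ → List ℕ → List ℕ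
  go acc []       = []
  go acc (a ∷ as) = (acc + a) ∷ go (acc + a) as

-- eastIndex x (A₁,…,Aₙ) : the (1-based) smallest j with x < Aⱼ, where
-- Aⱼ = a₁+⋯+aⱼ.  The east step of D starting at x-coordinate x starts at
-- height k₁+⋯+k_j.
eastIndex : ℕ → List ℕ → ℕ
eastIndex x []       = 0
eastIndex x (A ∷ As) = if x <ᵇ A then 1 else suc (eastIndex x As)

countAtLeast : ℕ → List ℕ → ℕ
countAtLeast c []       = 0
countAtLeast c (e ∷ es) = (if c ≤ᵇ e then 1 else 0) + countAtLeast c es

-- State of the algorithm: step i, x-coordinate of Pᵢ, number s of north
-- steps below Pᵢ (y(Pᵢ) = k₁+⋯+k_s), and for each filled column j of R
-- the bottom entry iⱼ + kⱼ (column j filled at step iⱼ holds exactly the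
-- values iⱼ,…,iⱼ+kⱼ).  Returns Σ i·vᵢ.  The loop runs while
-- Pᵢ ≠ (K,K), i.e. while not (x = K and s = n) (all kⱼ > 0);
-- `fuel` only guarantees structural termination and is chosen large
-- enough (the algorithm takes at most K iterations).
bounceLoop : (fuel : ℕ) → (ks As : List ℕ) → (K n : ℕ) →
             (i x s : ℕ) → (levels : List ℕ) → ℕ
bounceLoop zero       ks As K n i x s levels = 0
bounceLoop (suc fuel) ks As K n i x s levels =
  if (x ≡ᵇ K) ∧ (s ≡ᵇ n) then 0 else
    (let j       = eastIndex x As
         v       = j ∸ s
         levels′ = levels ++ map (i +_) (take v (drop s ks))
         h       = countAtLeast (suc i) levels′
     in i * v + bounceLoop fuel ks As K n (suc i) (x + h) j levels′)

bounce : List ℕ → List ℕ → ℕ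
bounce ks as =
  bounceLoop (suc (sum ks + length ks)) ks (prefixSums as) (sum ks) (length ks) 0 0 0 []

countPaths : List ℕ → ℕ → ℕ → List (List ℕ) → ℕ
countPaths ks a b []         = 0
countPaths ks a b (as ∷ ass) =
  (if (area ks as ≡ᵇ a) ∧ (bounce ks as ≡ᵇ b) then 1 else 0) + countPaths ks a b ass

catalanCoeff : List ℕ → ℕ → ℕ → ℕ
catalanCoeff ks a b = countPaths ks a b (dyckPaths ks)

-- The vector (k, k+m, k+m, k+m), with the convention of the paper:
-- for k = 0 < m it is (m,m,m), and for k = m = 0 it is the empty
-- vector (giving C = 1, the single empty path).
kVec : ℕ → ℕ → List ℕ
kVec k m = (if k ≡ᵇ 0 then [] else k ∷ []) ++
           (if (k + m) ≡ᵇ 0 then [] else (k + m) ∷ (k + m) ∷ (k + m) ∷ [])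

Hcoeff : ℕ → ℕ → ℕ → ℕ → ℕ
Hcoeff k m a b = catalanCoeff (kVec k m) a b

-- Polynomials in x,y,q,t with integer coefficients, as lists of terms
-- (c , (i , j , a , b))  standing for  c·x^i y^j q^a t^b.

Term : Set
Term = ℤ × (ℕ × ℕ × ℕ × ℕ)

Poly : Set
Poly = List Term

mon : ℤ → ℕ → ℕ → ℕ → ℕ → Term
mon c i j a b = c , (i , j , a , b)

polyMul : Poly → Poly → Poly
polyMul P Q = concatMap (λ { (c , (i , j , a , b)) →
  map (λ { (d , (i′ , j′ , a′ , b′)) → (c ℤ.* d) , (i + i′ , j + j′ , a + a′ , b + b′) }) Q }) P

polyCoeff : Poly → ℕ → ℕ → ℕ → ℕ → ℤ
polyCoeff []                          k m a b = ℤ.0ℤ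
polyCoeff ((c , (i , j , a′ , b′)) ∷ P) k m a b =
  (if (i ≡ᵇ k) ∧ (j ≡ᵇ m) ∧ (a′ ≡ᵇ a) ∧ (b′ ≡ᵇ b) then c else ℤ.0ℤ)
  ℤ.+ polyCoeff P k m a b

polyTimesHCoeff : Poly → ℕ → ℕ → ℕ → ℕ → ℤ
polyTimesHCoeff []                          k m a b = ℤ.0ℤ
polyTimesHCoeff ((c , (i , j , α , β)) ∷ P) k m a b =
  (if (i ≤ᵇ k) ∧ (j ≤ᵇ m) ∧ (α ≤ᵇ a) ∧ (β ≤ᵇ b)
     then c ℤ.* ℤ.+ (Hcoeff (k ∸ i) (m ∸ j) (a ∸ α) (b ∸ β))
     else ℤ.0ℤ)
  ℤ.+ polyTimesHCoeff P k m a b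

one-minus : ℕ → ℕ → ℕ → ℕ → Poly
one-minus i j a b = mon (ℤ.+ 1) 0 0 0 0 ∷ mon (ℤ.- (ℤ.+ 1)) i j a b ∷ []

denom : Poly
denom = foldr polyMul (mon (ℤ.+ 1) 0 0 0 0 ∷ [])
  ( one-minus 1 0 6 0 ∷ one-minus 1 0 0 6 ∷ one-minus 1 0 3 1 ∷ one-minus 1 0 1 3
  ∷ one-minus 1 0 2 2 ∷ one-minus 0 1 3 0 ∷ one-minus 0 1 0 3 ∷ one-minus 0 1 1 1 ∷ [])

private
  grp : ℕ → ℕ → List (ℤ × ℕ × ℕ) → Poly
  grp i j = map (λ { (c , a , b) → mon c i j a b })
  p : ℕ → ℕ → ℤ × ℕ × ℕ
  p a b = ℤ.+ 1 , a , b
  p2 : ℕ → ℕ → ℤ × ℕ × ℕ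
  p2 a b = ℤ.+ 2 , a , b
  n : ℕ → ℕ → ℤ × ℕ × ℕ
  n a b = ℤ.- (ℤ.+ 1) , a , b
  n2 : ℕ → ℕ → ℤ × ℕ × ℕ
  n2 a b = ℤ.- (ℤ.+ 2) , a , b

M : Poly
M =
  grp 3 2 (p 13 7 ∷ p 7 13 ∷ p 12 8 ∷ p 8 12 ∷ p 9 12 ∷ p 12 9 ∷ p 11 11 ∷ p 10 11 ∷ p 11 10 ∷ p 9 11 ∷ p 11 9 ∷ p 10 10 ∷ [])
  ++ grp 2 2 (n 11 5 ∷ n 5 11 ∷ n 10 6 ∷ n 6 10 ∷ n 8 9 ∷ n 9 8 ∷ n 7 9 ∷ n 9 7 ∷ n 8 8 ∷ p 7 8 ∷ p 8 7 ∷ n 7 7 ∷ [])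
  ++ grp 1 2 (n 7 4 ∷ n 4 7 ∷ n 6 5 ∷ n 5 6 ∷ [])
  ++ grp 3 1 (n 12 6 ∷ n 6 12 ∷ n 8 11 ∷ n 11 8 ∷ n 10 8 ∷ n 8 10 ∷ n 7 11 ∷ n 11 7 ∷ n 7 10 ∷ n 10 7 ∷ n2 9 9 ∷ n 8 9 ∷ n 9 8 ∷ [])
  ++ grp 2 1 (n 10 3 ∷ n 3 10 ∷ n 5 7 ∷ n 7 5 ∷ p 5 9 ∷ p 9 5 ∷ n 4 9 ∷ n 9 4 ∷ n 4 8 ∷ n 8 4 ∷ n 5 6 ∷ n 6 5 ∷ p 8 6 ∷ p 6 8 ∷ [])
  ++ grp 1 1 (p 1 8 ∷ p 8 1 ∷ p 1 7 ∷ p 7 1 ∷ p 6 3 ∷ p 3 6 ∷ p 4 5 ∷ p 5 4 ∷ p 2 5 ∷ p 5 2 ∷ p2 4 4 ∷ p 5 3 ∷ p 3 5 ∷ p2 3 4 ∷ p2 4 3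
              ∷ p 7 2 ∷ p 2 7 ∷ p 6 2 ∷ p 2 6 ∷ [])
  ++ grp 0 1 (n 2 1 ∷ n 1 2 ∷ [])
  ++ grp 3 0 (p 9 6 ∷ p 6 9 ∷ p 8 7 ∷ p 7 8 ∷ p 8 8 ∷ [])
  ++ grp 2 0 (p 7 3 ∷ p 3 7 ∷ n 5 6 ∷ n 6 5 ∷ p 4 6 ∷ p 6 4 ∷ p 5 5 ∷ p 4 5 ∷ p 5 4 ∷ [])
  ++ grp 1 0 (n 1 5 ∷ n 5 1 ∷ n 2 4 ∷ n 4 2 ∷ n 1 4 ∷ n 4 1 ∷ n 3 3 ∷ n 2 3 ∷ n 3 2 ∷ [])
  ++ grp 0 0 (n 0 0 ∷ [])

{-# OPTIONS --safe #-}

-- Let i_j be the iteration of the bounce algorithm that fills column j.  Then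
-- bounce = i_2 + i_3 + i_4 and i_j is the first i at which the abscissa of P_i
-- reaches a_1 + … + a_{j-1}; that abscissa advances by the number of columns
-- still active, so by 3, 2 or 1.  Grouping a_2 and a_3 accordingly into triples,
-- pairs and single values makes area and bounce linear on finitely many cones,
-- which split into simplicial cones all of whose generators have degree one in x
-- or in y.  Every cone then contributes a simple numerator over a product of
-- factors 1 - x q^α t^β and 1 - y q^α t^β.  Besides the eight factors of the
-- theorem, four more occur, and they cancel in the sum.
module Submission where

open import Defs
open import Data.Bool using (Bool; true; false; if_then_else_; _∧_; T)
import Data.Bool.Properties as BoolP
open import Data.Integer as ℤ using (ℤ; 0ℤ; 1ℤ; -1ℤ; -_) renaming (_+_ to _⊕_; _*_ to _⊛_; _-_ to _⊖_)
import Data.Integer.Properties as ℤP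
import Algebra.Properties.AbelianGroup ℤP.+-0-abelianGroup as ℤGroup
import Data.Integer.Tactic.RingSolver as ℤRing
open import Data.List using (List; []; _∷_; _++_; map; foldr; concatMap; applyUpTo; take; drop)
import Data.List.Properties as ListP
open import Data.Maybe as Maybe using (Maybe; just; nothing; _>>=_)
open import Data.Nat using (ℕ; zero; suc; _+_; _*_; _∸_; _≡ᵇ_; _<ᵇ_; _≤ᵇ_; _≤_; _<_; z≤n; s≤s; z<s; s<s)
open import Data.Nat.ListAction using (sum)
import Data.Nat.Properties as ℕP
import Data.Nat.Tactic.RingSolver as ℕRing
open import Data.Product using (_×_; _,_; proj₁; proj₂; ∃)
open import Data.Unit using (tt)
open import Function using (_∘_)
open import Relation.Binary.PropositionalEquality
  using (_≡_; refl; sym; trans; cong; cong₂; subst; subst₂; module ≡-Reasoning)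
open import Relation.Nullary using (contradiction)

-- Sums over u + r = n

-- The obstacle is overshooting. At speed 2 or 3 the abscissa can jump past the value it has to
-- reach, so neighbouring values of a₂ or a₃ give the same time but different areas, and an
-- overshoot past a₂ shortens the next leg. The groups absorb this: within a group the area grows by
-- 1 or 2, which costs a factor q or q², and the shortened leg leaves one irregular term. No
-- quotient of power series is formed. Both sides are multiplied by all twelve factors 1 - g; each
-- cone then becomes a polynomial, and the theorem reduces to one equality of explicit polynomials,
-- which the type checker evaluates. The four extra factors can be taken off again because
-- multiplication by 1 - g is injective when g has positive degree in x or y. The ring ℤ[q,t] is
-- never built either: all series are seen through an arbitrary functional `ℓ`, and only at the end
-- is `ℓ` chosen as the extraction of one coefficient.

Σ⟨_⟩ : ℕ → (ℕ → ℕ → ℤ) → ℤ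
Σ⟨ zero ⟩  f = f 0 0
Σ⟨ suc n ⟩ f = f 0 (suc n) ⊕ Σ⟨ n ⟩ (λ u r → f (suc u) r)

-- A guard instead of a shifted index: summands with truncated subtraction, such as
-- `f (c * 2 ∸ 1) r`, may then be meaningless at 0, and the lemmas on `Σ⟨ n ⟩` carry over to sums
-- over positive values.
pos : ℕ → ℤ → ℤ
pos zero    _ = 0ℤ
pos (suc _) z = z

Σ⁺⟨_⟩ : ℕ → (ℕ → ℕ → ℤ) → ℤ
Σ⁺⟨ n ⟩ f = Σ⟨ n ⟩ (λ u r → pos u (f u r))

Σ-cong : ∀ n {f g : ℕ → ℕ → ℤ} → (∀ u r → u + r ≡ n → f u r ≡ g u r) → Σ⟨ n ⟩ f ≡ Σ⟨ n ⟩ g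
Σ-cong zero    f≗g = f≗g 0 0 refl
Σ-cong (suc n) f≗g = cong₂ _⊕_ (f≗g 0 (suc n) refl) (Σ-cong n (λ u r eq → f≗g (suc u) r (cong suc eq)))

Σ⁺-cong : ∀ n {f g : ℕ → ℕ → ℤ} → (∀ u r → suc u + r ≡ n → f (suc u) r ≡ g (suc u) r) → Σ⁺⟨ n ⟩ f ≡ Σ⁺⟨ n ⟩ g
Σ⁺-cong n {f} {g} f≗g = Σ-cong n lemma
  where
  lemma : ∀ u r → u + r ≡ n → pos u (f u r) ≡ pos u (g u r)
  lemma zero    r eq = refl
  lemma (suc u) r eq = f≗g u r eq

+-interchange : ∀ a b c d → (a ⊕ b) ⊕ (c ⊕ d) ≡ (a ⊕ c) ⊕ (b ⊕ d)
+-interchange = ℤRing.solve-∀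

Σ-+ : ∀ n (f g : ℕ → ℕ → ℤ) → Σ⟨ n ⟩ (λ u r → f u r ⊕ g u r) ≡ Σ⟨ n ⟩ f ⊕ Σ⟨ n ⟩ g
Σ-+ zero    f g = refl
Σ-+ (suc n) f g =
  trans (cong ((f 0 (suc n) ⊕ g 0 (suc n)) ⊕_) (Σ-+ n (λ u → f (suc u)) (λ u → g (suc u))))
        (+-interchange (f 0 (suc n)) (g 0 (suc n)) _ _)

pos-+ : ∀ n x y → pos n (x ⊕ y) ≡ pos n x ⊕ pos n y
pos-+ zero    x y = refl
pos-+ (suc n) x y = refl

Σ⁺-+ : ∀ n (f g : ℕ → ℕ → ℤ) → Σ⁺⟨ n ⟩ (λ u r → f u r ⊕ g u r) ≡ Σ⁺⟨ n ⟩ f ⊕ Σ⁺⟨ n ⟩ g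
Σ⁺-+ n f g = trans (Σ-cong n (λ u r _ → pos-+ u (f u r) (g u r))) (Σ-+ n _ _)

Σ-0 : ∀ n → Σ⟨ n ⟩ (λ _ _ → 0ℤ) ≡ 0ℤ
Σ-0 zero    = refl
Σ-0 (suc n) = trans (ℤP.+-identityˡ _) (Σ-0 n)

pos-Σ : ∀ p n f → pos p (Σ⟨ n ⟩ f) ≡ Σ⟨ n ⟩ (λ u r → pos p (f u r))
pos-Σ zero    n f = sym (Σ-0 n)
pos-Σ (suc p) n f = refl

Σ-swap : ∀ n n′ (f : ℕ → ℕ → ℕ → ℕ → ℤ) →
  Σ⟨ n ⟩ (λ u r → Σ⟨ n′ ⟩ (f u r)) ≡ Σ⟨ n′ ⟩ (λ u′ r′ → Σ⟨ n ⟩ (λ u r → f u r u′ r′))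
Σ-swap zero    n′ f = refl
Σ-swap (suc n) n′ f =
  trans (cong (Σ⟨ n′ ⟩ (f 0 (suc n)) ⊕_) (Σ-swap n n′ (λ u → f (suc u))))
        (sym (Σ-+ n′ _ _))

-- Both sides run over all a + b + c = n, once with c and once with a chosen first.
Σ-assoc : ∀ n (f : ℕ → ℕ → ℕ → ℤ) →
  Σ⟨ n ⟩ (λ s c → Σ⟨ s ⟩ (λ a b → f a b c)) ≡ Σ⟨ n ⟩ (λ a s → Σ⟨ s ⟩ (f a))
Σ-assoc zero    f = refl
Σ-assoc (suc n) f = begin
  f 0 0 (suc n) ⊕ Σ⟨ n ⟩ (λ s c → f 0 (suc s) c ⊕ Σ⟨ s ⟩ (λ a b → f (suc a) b c))
    ≡⟨ cong (f 0 0 (suc n) ⊕_) (Σ-+ n _ _) ⟩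
  f 0 0 (suc n) ⊕ (Σ⟨ n ⟩ (λ s c → f 0 (suc s) c) ⊕ Σ⟨ n ⟩ (λ s c → Σ⟨ s ⟩ (λ a b → f (suc a) b c)))
    ≡⟨ ℤP.+-assoc (f 0 0 (suc n)) _ _ ⟨
  Σ⟨ suc n ⟩ (f 0) ⊕ Σ⟨ n ⟩ (λ s c → Σ⟨ s ⟩ (λ a b → f (suc a) b c))
    ≡⟨ cong (Σ⟨ suc n ⟩ (f 0) ⊕_) (Σ-assoc n (λ a → f (suc a))) ⟩
  Σ⟨ suc n ⟩ (f 0) ⊕ Σ⟨ n ⟩ (λ a s → Σ⟨ s ⟩ (f (suc a))) ∎
  where open ≡-Reasoning

Σ⁺-first : ∀ n f → Σ⟨ n ⟩ f ≡ f 0 n ⊕ Σ⁺⟨ n ⟩ f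
Σ⁺-first zero    f = sym (ℤP.+-identityʳ _)
Σ⁺-first (suc n) f = cong (f 0 (suc n) ⊕_) (sym (ℤP.+-identityˡ _))

-- The boundary value M belongs to the first part, so the second part is a positive sum in both
-- variants. The two proofs alternate: a positive sum loses its guarded term at 0, a full sum splits
-- that term off.
Σ⁺-split : ∀ M N f → Σ⁺⟨ M + N ⟩ f ≡ Σ⁺⟨ M ⟩ (λ a r → f a (r + N)) ⊕ Σ⁺⟨ N ⟩ (λ a r → f (M + a) r)
Σ-split  : ∀ M N f → Σ⟨ M + N ⟩ f ≡ Σ⟨ M ⟩ (λ a r → f a (r + N)) ⊕ Σ⁺⟨ N ⟩ (λ a r → f (M + a) r)
Σ⁺-split zero    N f = sym (ℤP.+-identityˡ _)
Σ⁺-split (suc M) N f = begin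
  0ℤ ⊕ Σ⟨ M + N ⟩ (λ u → f (suc u))
    ≡⟨ cong (0ℤ ⊕_) (Σ-split M N (λ u → f (suc u))) ⟩
  0ℤ ⊕ (Σ⟨ M ⟩ (λ a r → f (suc a) (r + N)) ⊕ Σ⁺⟨ N ⟩ (λ a r → f (suc M + a) r))
    ≡⟨ ℤP.+-assoc 0ℤ (Σ⟨ M ⟩ (λ a r → f (suc a) (r + N))) _ ⟨
  0ℤ ⊕ Σ⟨ M ⟩ (λ a r → f (suc a) (r + N)) ⊕ Σ⁺⟨ N ⟩ (λ a r → f (suc M + a) r) ∎
  where open ≡-Reasoning
Σ-split M N f = begin
  Σ⟨ M + N ⟩ f
    ≡⟨ Σ⁺-first (M + N) f ⟩
  f 0 (M + N) ⊕ Σ⁺⟨ M + N ⟩ f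
    ≡⟨ cong (f 0 (M + N) ⊕_) (Σ⁺-split M N f) ⟩
  f 0 (M + N) ⊕ (Σ⁺⟨ M ⟩ (λ a r → f a (r + N)) ⊕ Σ⁺⟨ N ⟩ (λ a r → f (M + a) r))
    ≡⟨ ℤP.+-assoc (f 0 (M + N)) (Σ⁺⟨ M ⟩ (λ a r → f a (r + N))) _ ⟨
  f 0 (M + N) ⊕ Σ⁺⟨ M ⟩ (λ a r → f a (r + N)) ⊕ Σ⁺⟨ N ⟩ (λ a r → f (M + a) r)
    ≡⟨ cong (_⊕ Σ⁺⟨ N ⟩ (λ a r → f (M + a) r)) (Σ⁺-first M (λ a r → f a (r + N))) ⟨
  Σ⟨ M ⟩ (λ a r → f a (r + N)) ⊕ Σ⁺⟨ N ⟩ (λ a r → f (M + a) r) ∎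
  where open ≡-Reasoning

Σ-pairs : ∀ g f → Σ⟨ suc (g * 2) ⟩ f ≡ Σ⟨ g ⟩ (λ c r → f (suc (c * 2)) (r * 2) ⊕ f (c * 2) (suc (r * 2)))
Σ-pairs zero    f = ℤP.+-comm (f 0 1) (f 1 0)
Σ-pairs (suc g) f =
  trans (cong (λ z → f 0 (3 + g * 2) ⊕ (f 1 (2 + g * 2) ⊕ z)) (Σ-pairs g (λ u → f (2 + u))))
        (rearrange (f 0 (3 + g * 2)) (f 1 (2 + g * 2)) _)
  where
  rearrange : ∀ a b s → a ⊕ (b ⊕ s) ≡ (b ⊕ a) ⊕ s
  rearrange = ℤRing.solve-∀

Σ-triples : ∀ g f → Σ⟨ 2 + g * 3 ⟩ f ≡
  Σ⟨ g ⟩ (λ c r → f (2 + c * 3) (r * 3) ⊕ (f (1 + c * 3) (1 + r * 3) ⊕ f (c * 3) (2 + r * 3)))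
Σ-triples zero    f = rearrange (f 0 2) (f 1 1) (f 2 0)
  where
  rearrange : ∀ a b c → a ⊕ (b ⊕ c) ≡ c ⊕ (b ⊕ a)
  rearrange = ℤRing.solve-∀
Σ-triples (suc g) f =
  trans (cong (λ z → f 0 (5 + g * 3) ⊕ (f 1 (4 + g * 3) ⊕ (f 2 (3 + g * 3) ⊕ z))) (Σ-triples g (λ u → f (3 + u))))
        (rearrange (f 0 (5 + g * 3)) (f 1 (4 + g * 3)) (f 2 (3 + g * 3)) _)
  where
  rearrange : ∀ a b c s → a ⊕ (b ⊕ (c ⊕ s)) ≡ (c ⊕ (b ⊕ a)) ⊕ s
  rearrange = ℤRing.solve-∀

-- Without 0, the values up to 2g fall into the pairs 2c - 1, 2c, which are the distances covered in
-- exactly c steps at speed 2, the last step possibly overshooting. The triples play the same role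
-- for speed 3.
Σ⁺-pairs : ∀ g f → Σ⁺⟨ g * 2 ⟩ f ≡
  Σ⁺⟨ g ⟩ (λ c r → f (c * 2) (r * 2) ⊕ f (c * 2 ∸ 1) (1 + r * 2))
Σ⁺-pairs zero    f = refl
Σ⁺-pairs (suc g) f = cong (0ℤ ⊕_) (Σ-pairs g (λ u → f (suc u)))

Σ⁺-triples : ∀ g f → Σ⁺⟨ g * 3 ⟩ f ≡
  Σ⁺⟨ g ⟩ (λ c r → f (c * 3) (r * 3) ⊕ (f (c * 3 ∸ 1) (1 + r * 3) ⊕ f (c * 3 ∸ 2) (2 + r * 3)))
Σ⁺-triples zero    f = refl
Σ⁺-triples (suc g) f = cong (0ℤ ⊕_) (Σ-triples g (λ u → f (suc u)))

-- Power series

-- A power series F in x, y over ℤ[q,t] enters through the numbers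
-- F k m A B = ℓ(q^A t^B · [x^k y^m] F) for a fixed linear functional ℓ on
-- ℤ[q,t]: multiplication by q^α t^β then merely adds to the last two arguments.
Series : Set
Series = ℕ → ℕ → ℕ → ℕ → ℤ

infix 4 _≈_
_≈_ : Series → Series → Set
F ≈ G = ∀ k m A B → F k m A B ≡ G k m A B

shift : ℕ → (ℕ → ℤ) → ℕ → ℤ
shift zero    f k       = f k
shift (suc i) f zero    = 0ℤ
shift (suc i) f (suc k) = shift i f k

Mon : Set
Mon = ℕ × ℕ × ℕ × ℕ

infixr 7 _∙_ _▷_
_∙_ : Mon → Series → Series
((i , j , α , β) ∙ F) k m A B = shift i (λ k′ → shift j (λ m′ → F k′ m′ (α + A) (β + B)) m) k

-- Polynomials are data and series are functions on which they act, so an identity between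
-- polynomials can be evaluated and then transported to every series.
_▷_ : Poly → Series → Series
([]          ▷ F) k m A B = 0ℤ
(((c , g) ∷ P) ▷ F) k m A B = c ⊛ (g ∙ F) k m A B ⊕ (P ▷ F) k m A B

∇ : Mon → Series → Series
∇ g F k m A B = F k m A B ⊖ (g ∙ F) k m A B

∇s : List Mon → Series → Series
∇s gs F = foldr ∇ F gs

shift-cong : ∀ i {f g} → (∀ k → f k ≡ g k) → ∀ k → shift i f k ≡ shift i g k
shift-cong zero    f≗g k       = f≗g k
shift-cong (suc i) f≗g zero    = refl
shift-cong (suc i) f≗g (suc k) = shift-cong i f≗g k

shift-shift : ∀ i j f k → shift i (shift j f) k ≡ shift (i + j) f k
shift-shift zero    j f k       = refl
shift-shift (suc i) j f zero    = refl
shift-shift (suc i) j f (suc k) = shift-shift i j f k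

shift-0 : ∀ i k → shift i (λ _ → 0ℤ) k ≡ 0ℤ
shift-0 zero    k       = refl
shift-0 (suc i) zero    = refl
shift-0 (suc i) (suc k) = shift-0 i k

shift-linear : ∀ i c f g k → shift i (λ k → c ⊛ f k ⊕ g k) k ≡ c ⊛ shift i f k ⊕ shift i g k
shift-linear zero    c f g k       = refl
shift-linear (suc i) c f g zero    = sym (trans (ℤP.+-identityʳ _) (ℤP.*-zeroʳ c))
shift-linear (suc i) c f g (suc k) = shift-linear i c f g k

shift-comm : ∀ i j (f : ℕ → ℕ → ℤ) k m →
  shift i (λ k → shift j (f k) m) k ≡ shift j (λ m → shift i (λ k → f k m) k) m
shift-comm zero    j f k       m = refl
shift-comm (suc i) j f zero    m = sym (shift-0 j m)
shift-comm (suc i) j f (suc k) m = shift-comm i j f k m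

_⊙_ : Mon → Mon → Mon
(i , j , α , β) ⊙ (i′ , j′ , α′ , β′) = i + i′ , j + j′ , α + α′ , β + β′

∙-cong : ∀ g {F G} → F ≈ G → g ∙ F ≈ g ∙ G
∙-cong (i , j , α , β) F≈G k m A B =
  shift-cong i (λ k′ → shift-cong j (λ m′ → F≈G k′ m′ (α + A) (β + B)) m) k

∙-∙ : ∀ g h F → g ∙ h ∙ F ≈ (g ⊙ h) ∙ F
∙-∙ (i , j , α , β) (i′ , j′ , α′ , β′) F k m A B = begin
  shift i (λ k → shift j (λ m → shift i′ (λ k → shift j′ (λ m → F k m (α′ + (α + A)) (β′ + (β + B))) m) k) m) k
    ≡⟨ shift-cong i (λ k → shift-comm i′ j _ k m) k ⟨
  shift i (λ k → shift i′ (λ k → shift j (λ m → shift j′ (λ m → F k m (α′ + (α + A)) (β′ + (β + B))) m) m) k) k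
    ≡⟨ shift-shift i i′ _ k ⟩
  shift (i + i′) (λ k → shift j (λ m → shift j′ (λ m → F k m (α′ + (α + A)) (β′ + (β + B))) m) m) k
    ≡⟨ shift-cong (i + i′) (λ k → shift-shift j j′ _ m) k ⟩
  shift (i + i′) (λ k → shift (j + j′) (λ m → F k m (α′ + (α + A)) (β′ + (β + B))) m) k
    ≡⟨ shift-cong (i + i′) (λ k → shift-cong (j + j′) (λ m →
         cong₂ (F k m) (lemma α α′ A) (lemma β β′ B)) m) k ⟩
  shift (i + i′) (λ k → shift (j + j′) (λ m → F k m (α + α′ + A) (β + β′ + B)) m) k ∎
  where
  open ≡-Reasoning
  lemma : ∀ a a′ n → a′ + (a + n) ≡ a + a′ + n
  lemma = ℕRing.solve-∀

⊙-comm : ∀ g h → g ⊙ h ≡ h ⊙ g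
⊙-comm (i , j , α , β) (i′ , j′ , α′ , β′) =
  cong₂ _,_ (ℕP.+-comm i i′) (cong₂ _,_ (ℕP.+-comm j j′) (cong₂ _,_ (ℕP.+-comm α α′) (ℕP.+-comm β β′)))

∙-comm : ∀ g h F → g ∙ h ∙ F ≈ h ∙ g ∙ F
∙-comm g h F k m A B =
  trans (∙-∙ g h F k m A B)
        (trans (cong (λ g → (g ∙ F) k m A B) (⊙-comm g h)) (sym (∙-∙ h g F k m A B)))

∙-linear : ∀ g c F G → g ∙ (λ k m A B → c ⊛ F k m A B ⊕ G k m A B) ≈
                       λ k m A B → c ⊛ (g ∙ F) k m A B ⊕ (g ∙ G) k m A B
∙-linear (i , j , α , β) c F G k m A B =
  trans (shift-cong i (λ k → shift-linear j c _ _ m) k) (shift-linear i c _ _ k)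

∙-0 : ∀ g → g ∙ (λ _ _ _ _ → 0ℤ) ≈ λ _ _ _ _ → 0ℤ
∙-0 (i , j , α , β) k m A B = trans (shift-cong i (λ _ → shift-0 j m) k) (shift-0 i k)

∙-⊖ : ∀ g F G → g ∙ (λ k m A B → F k m A B ⊖ G k m A B) ≈ λ k m A B → (g ∙ F) k m A B ⊖ (g ∙ G) k m A B
∙-⊖ g F G k m A B = begin
  (g ∙ (λ k m A B → F k m A B ⊖ G k m A B)) k m A B
    ≡⟨ ∙-cong g (λ k m A B → lemma (F k m A B) (G k m A B)) k m A B ⟩
  (g ∙ (λ k m A B → -1ℤ ⊛ G k m A B ⊕ F k m A B)) k m A B
    ≡⟨ ∙-linear g -1ℤ G F k m A B ⟩
  -1ℤ ⊛ (g ∙ G) k m A B ⊕ (g ∙ F) k m A B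
    ≡⟨ lemma ((g ∙ F) k m A B) ((g ∙ G) k m A B) ⟨
  (g ∙ F) k m A B ⊖ (g ∙ G) k m A B ∎
  where
  open ≡-Reasoning
  lemma : ∀ a b → a ⊖ b ≡ -1ℤ ⊛ b ⊕ a
  lemma a b = trans (ℤP.+-comm a (ℤ.- b)) (cong (_⊕ a) (sym (ℤP.-1*i≡-i b)))

∇-cong : ∀ g {F G} → F ≈ G → ∇ g F ≈ ∇ g G
∇-cong g F≈G k m A B = cong₂ _⊖_ (F≈G k m A B) (∙-cong g F≈G k m A B)

∇s-cong : ∀ gs {F G} → F ≈ G → ∇s gs F ≈ ∇s gs G
∇s-cong []       F≈G = F≈G
∇s-cong (g ∷ gs) F≈G = ∇-cong g (∇s-cong gs F≈G)

∇-comm : ∀ g h F → ∇ g (∇ h F) ≈ ∇ h (∇ g F)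
∇-comm g h F k m A B = begin
  (F k m A B ⊖ (h ∙ F) k m A B) ⊖ (g ∙ ∇ h F) k m A B
    ≡⟨ cong ((F k m A B ⊖ (h ∙ F) k m A B) ⊖_) (∙-⊖ g F (h ∙ F) k m A B) ⟩
  (F k m A B ⊖ (h ∙ F) k m A B) ⊖ ((g ∙ F) k m A B ⊖ (g ∙ h ∙ F) k m A B)
    ≡⟨ cong (λ z → (F k m A B ⊖ (h ∙ F) k m A B) ⊖ ((g ∙ F) k m A B ⊖ z)) (∙-comm g h F k m A B) ⟩
  (F k m A B ⊖ (h ∙ F) k m A B) ⊖ ((g ∙ F) k m A B ⊖ (h ∙ g ∙ F) k m A B)
    ≡⟨ lemma (F k m A B) _ _ _ ⟩
  (F k m A B ⊖ (g ∙ F) k m A B) ⊖ ((h ∙ F) k m A B ⊖ (h ∙ g ∙ F) k m A B)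
    ≡⟨ cong ((F k m A B ⊖ (g ∙ F) k m A B) ⊖_) (∙-⊖ h F (g ∙ F) k m A B) ⟨
  (F k m A B ⊖ (g ∙ F) k m A B) ⊖ (h ∙ ∇ g F) k m A B ∎
  where
  open ≡-Reasoning
  lemma : ∀ f a b c → (f ⊖ a) ⊖ (b ⊖ c) ≡ (f ⊖ b) ⊖ (a ⊖ c)
  lemma = ℤRing.solve-∀

∇-∙ : ∀ g h F → ∇ g (h ∙ F) ≈ h ∙ ∇ g F
∇-∙ g h F k m A B =
  trans (cong ((h ∙ F) k m A B ⊖_) (∙-comm g h F k m A B)) (sym (∙-⊖ h F (g ∙ F) k m A B))

∇s-∙ : ∀ gs h F → ∇s gs (h ∙ F) ≈ h ∙ ∇s gs F
∇s-∙ []       h F k m A B = refl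
∇s-∙ (g ∷ gs) h F k m A B = trans (∇-cong g (∇s-∙ gs h F) k m A B) (∇-∙ g h (∇s gs F) k m A B)

∇s-comm : ∀ g gs F → ∇s gs (∇ g F) ≈ ∇ g (∇s gs F)
∇s-comm g []       F k m A B = refl
∇s-comm g (h ∷ gs) F k m A B = trans (∇-cong h (∇s-comm g gs F) k m A B) (∇-comm h g (∇s gs F) k m A B)

infixl 6 _⊞_
_⊞_ : Series → Series → Series
(F ⊞ G) k m A B = F k m A B ⊕ G k m A B

∇-⊞ : ∀ g F G → ∇ g (F ⊞ G) ≈ ∇ g F ⊞ ∇ g G
∇-⊞ g F G k m A B = begin
  (F k m A B ⊕ G k m A B) ⊖ (g ∙ (F ⊞ G)) k m A B
    ≡⟨ cong ((F k m A B ⊕ G k m A B) ⊖_) (∙-⊞ k m A B) ⟩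
  (F k m A B ⊕ G k m A B) ⊖ ((g ∙ F) k m A B ⊕ (g ∙ G) k m A B)
    ≡⟨ lemma (F k m A B) (G k m A B) _ _ ⟩
  (F k m A B ⊖ (g ∙ F) k m A B) ⊕ (G k m A B ⊖ (g ∙ G) k m A B) ∎
  where
  open ≡-Reasoning
  lemma : ∀ f h a b → (f ⊕ h) ⊖ (a ⊕ b) ≡ (f ⊖ a) ⊕ (h ⊖ b)
  lemma = ℤRing.solve-∀
  ∙-⊞ : g ∙ (F ⊞ G) ≈ g ∙ F ⊞ g ∙ G
  ∙-⊞ k m A B = begin
    (g ∙ (F ⊞ G)) k m A B
      ≡⟨ ∙-cong g (λ k m A B → cong (_⊕ G k m A B) (ℤP.*-identityˡ (F k m A B))) k m A B ⟨
    (g ∙ (λ k m A B → 1ℤ ⊛ F k m A B ⊕ G k m A B)) k m A B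
      ≡⟨ ∙-linear g 1ℤ F G k m A B ⟩
    1ℤ ⊛ (g ∙ F) k m A B ⊕ (g ∙ G) k m A B
      ≡⟨ cong (_⊕ (g ∙ G) k m A B) (ℤP.*-identityˡ ((g ∙ F) k m A B)) ⟩
    (g ∙ F) k m A B ⊕ (g ∙ G) k m A B ∎

∇s-⊞ : ∀ gs F G → ∇s gs (F ⊞ G) ≈ ∇s gs F ⊞ ∇s gs G
∇s-⊞ []       F G k m A B = refl
∇s-⊞ (g ∷ gs) F G k m A B = trans (∇-cong g (∇s-⊞ gs F G) k m A B) (∇-⊞ g (∇s gs F) (∇s gs G) k m A B)

-- Sparse polynomials, kept sorted by addition

eqᵐ ltᵐ : Mon → Mon → Bool
eqᵐ (i , j , α , β) (i′ , j′ , α′ , β′) = (i ≡ᵇ i′) ∧ (j ≡ᵇ j′) ∧ (α ≡ᵇ α′) ∧ (β ≡ᵇ β′)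
ltᵐ (i , j , α , β) (i′ , j′ , α′ , β′) =
  if i ≡ᵇ i′ then (if j ≡ᵇ j′ then (if α ≡ᵇ α′ then β <ᵇ β′ else α <ᵇ α′) else j <ᵇ j′) else i <ᵇ i′

≡ᵇ-true : ∀ m n → (m ≡ᵇ n) ≡ true → m ≡ n
≡ᵇ-true m n eq = ℕP.≡ᵇ⇒≡ m n (subst T (sym eq) tt)

∧-true : ∀ {a b} → a ∧ b ≡ true → a ≡ true × b ≡ true
∧-true {true} eq = refl , eq

eqᵐ-true : ∀ g h → eqᵐ g h ≡ true → g ≡ h
eqᵐ-true (i , j , α , β) (i′ , j′ , α′ , β′) eq
  with (p , eq) ← ∧-true eq
  with (q , eq) ← ∧-true eq
  with (r , s) ← ∧-true eq
  with refl ← ≡ᵇ-true i i′ p | refl ← ≡ᵇ-true j j′ q | refl ← ≡ᵇ-true α α′ r | refl ← ≡ᵇ-true β β′ s = refl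

-- Zero coefficients are dropped so that equal polynomials reach the same normal form and can be
-- compared by `refl`.
cons : ℤ → Mon → Poly → Poly
cons (ℤ.+ 0) g P = P
cons c       g P = (c , g) ∷ P

add : Poly → Poly → Poly
add []              Q               = Q
add P@(_ ∷ _)       []              = P
add P@((c , g) ∷ P′) Q@((d , h) ∷ Q′) =
  if ltᵐ g h then (c , g) ∷ add P′ Q
  else if eqᵐ g h then cons (c ⊕ d) g (add P′ Q′)
  else (d , h) ∷ add P Q′

scale : ℤ → Mon → Poly → Poly
scale c g []            = []
scale c g ((d , h) ∷ P) = (c ⊛ d , g ⊙ h) ∷ scale c g P

∇ᵖ : Mon → Poly → Poly
∇ᵖ g P = add P (scale -1ℤ g P)

∇sᵖ : List Mon → Poly → Poly
∇sᵖ gs P = foldr ∇ᵖ P gs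

cons-▷ : ∀ c g P F → cons c g P ▷ F ≈ ((c , g) ∷ P) ▷ F
cons-▷ (ℤ.+ 0)       g P F k m A B = sym (ℤP.+-identityˡ _)
cons-▷ (ℤ.+ (suc _)) g P F k m A B = refl
cons-▷ (ℤ.-[1+ _ ])  g P F k m A B = refl

Additive : Poly → Poly → Series → Set
Additive P Q F = add P Q ▷ F ≈ P ▷ F ⊞ Q ▷ F

-- The three induction hypotheses are arguments, which keeps the case distinction on the leading
-- monomials apart from the recursion in `add-▷`.
add-∷-▷ : ∀ c g P d h Q F →
  Additive P ((d , h) ∷ Q) F → Additive P Q F → Additive ((c , g) ∷ P) Q F →
  Additive ((c , g) ∷ P) ((d , h) ∷ Q) F
add-∷-▷ c g P d h Q F ihˡ ihᵐ ihʳ k m A B with ltᵐ g h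
... | true = trans (cong (c ⊛ (g ∙ F) k m A B ⊕_) (ihˡ k m A B)) (sym (ℤP.+-assoc (c ⊛ (g ∙ F) k m A B) _ _))
... | false with eqᵐ g h in eq
...   | true with refl ← eqᵐ-true g h eq =
        trans (cons-▷ (c ⊕ d) g (add P Q) F k m A B)
              (trans (cong ((c ⊕ d) ⊛ (g ∙ F) k m A B ⊕_) (ihᵐ k m A B)) (collect c d _ _ _))
  where
  collect : ∀ c d f a b → (c ⊕ d) ⊛ f ⊕ (a ⊕ b) ≡ (c ⊛ f ⊕ a) ⊕ (d ⊛ f ⊕ b)
  collect = ℤRing.solve-∀
...   | false = trans (cong (d ⊛ (h ∙ F) k m A B ⊕_) (ihʳ k m A B))
                      (swap (d ⊛ (h ∙ F) k m A B) ((((c , g) ∷ P) ▷ F) k m A B) _)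
  where
  swap : ∀ a p q → a ⊕ (p ⊕ q) ≡ p ⊕ (a ⊕ q)
  swap = ℤRing.solve-∀

add-▷ : ∀ P Q F → Additive P Q F
add-▷ []            Q             F k m A B = sym (ℤP.+-identityˡ _)
add-▷ (_ ∷ _)       []            F k m A B = sym (ℤP.+-identityʳ _)
add-▷ ((c , g) ∷ P) ((d , h) ∷ Q) F =
  add-∷-▷ c g P d h Q F (add-▷ P ((d , h) ∷ Q) F) (add-▷ P Q F) (add-▷ ((c , g) ∷ P) Q F)

scale-▷ : ∀ c g P F → scale c g P ▷ F ≈ λ k m A B → c ⊛ (g ∙ P ▷ F) k m A B
scale-▷ c g []            F k m A B = sym (trans (cong (c ⊛_) (∙-0 g k m A B)) (ℤP.*-zeroʳ c))
scale-▷ c g ((d , h) ∷ P) F k m A B = begin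
  (c ⊛ d) ⊛ ((g ⊙ h) ∙ F) k m A B ⊕ (scale c g P ▷ F) k m A B
    ≡⟨ cong₂ (λ x y → (c ⊛ d) ⊛ x ⊕ y) (sym (∙-∙ g h F k m A B)) (scale-▷ c g P F k m A B) ⟩
  (c ⊛ d) ⊛ (g ∙ h ∙ F) k m A B ⊕ c ⊛ (g ∙ P ▷ F) k m A B
    ≡⟨ lemma c d _ _ ⟩
  c ⊛ (d ⊛ (g ∙ h ∙ F) k m A B ⊕ (g ∙ P ▷ F) k m A B)
    ≡⟨ cong (c ⊛_) (∙-linear g d (h ∙ F) (P ▷ F) k m A B) ⟨
  c ⊛ (g ∙ ((d , h) ∷ P) ▷ F) k m A B ∎
  where
  open ≡-Reasoning
  lemma : ∀ c d x y → (c ⊛ d) ⊛ x ⊕ c ⊛ y ≡ c ⊛ (d ⊛ x ⊕ y)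
  lemma = ℤRing.solve-∀

scale1-▷ : ∀ g P F → scale 1ℤ g P ▷ F ≈ g ∙ P ▷ F
scale1-▷ g P F k m A B = trans (scale-▷ 1ℤ g P F k m A B) (ℤP.*-identityˡ _)

∇ᵖ-▷ : ∀ g P F → ∇ᵖ g P ▷ F ≈ ∇ g (P ▷ F)
∇ᵖ-▷ g P F k m A B =
  trans (add-▷ P _ F k m A B)
        (cong ((P ▷ F) k m A B ⊕_) (trans (scale-▷ -1ℤ g P F k m A B) (ℤP.-1*i≡-i _)))

∇sᵖ-▷ : ∀ gs P F → ∇sᵖ gs P ▷ F ≈ ∇s gs (P ▷ F)
∇sᵖ-▷ []       P F k m A B = refl
∇sᵖ-▷ (g ∷ gs) P F k m A B = trans (∇ᵖ-▷ g (∇sᵖ gs P) F k m A B) (∇-cong g (∇sᵖ-▷ gs P F) k m A B)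

one : Poly
one = (1ℤ , 0 , 0 , 0 , 0) ∷ []

one-▷ : ∀ F → one ▷ F ≈ F
one-▷ F k m A B = trans (ℤP.+-identityʳ _) (ℤP.*-identityˡ _)

sort : Poly → Poly
sort = foldr (λ s → add (s ∷ [])) []

sort-▷ : ∀ P F → sort P ▷ F ≈ P ▷ F
sort-▷ []            F k m A B = refl
sort-▷ ((c , g) ∷ P) F k m A B =
  trans (add-▷ ((c , g) ∷ []) (sort P) F k m A B)
        (cong₂ _⊕_ (ℤP.+-identityʳ (c ⊛ (g ∙ F) k m A B)) (sort-▷ P F k m A B))

remove : Mon → List Mon → Maybe (List Mon)
remove g []       = nothing
remove g (h ∷ hs) = if eqᵐ g h then just hs else Maybe.map (h ∷_) (remove g hs)

∇s-remove : ∀ g gs {hs} → remove g gs ≡ just hs → ∀ F → ∇s gs F ≈ ∇s hs (∇ g F)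
∇s-remove g (h ∷ gs) eq F k m A B with eqᵐ g h in g≡h
∇s-remove g (h ∷ gs) refl F k m A B | true with refl ← eqᵐ-true g h g≡h = sym (∇s-comm g gs F k m A B)
∇s-remove g (h ∷ gs) eq F k m A B | false with remove g gs in eq′
∇s-remove g (h ∷ gs) refl F k m A B | false | just hs = ∇-cong h (∇s-remove g gs eq′ F) k m A B

-- Sums of monomials over orthants

data Axis : Set where
  𝐱 𝐲 : Axis

gen : Axis → ℕ → ℕ → Mon
gen 𝐱 α β = 1 , 0 , α , β
gen 𝐲 α β = 0 , 1 , α , β

-- geo stands for Σ_u g^u · e with u ≥ 0, and geo⁺ for the same sum with u ≥ 1;
-- base for the sum of all products of powers of an x- and a y-generator.
infixl 6 _∔_
data Expr : Set where
  base     : (α β γ ζ : ℕ) → Expr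
  geo geo⁺ : Axis → (α β : ℕ) → Expr → Expr
  q·       : Expr → Expr
  _∔_      : Expr → Expr → Expr

-- The numerator of an expression over the common denominator ∏ (1 - g), g ∈ gs.
num : List Mon → Expr → Maybe Poly
-- The factors of the common denominator that a cone does not use end up in its numerator.
num gs (base α β γ ζ) = remove (gen 𝐱 α β) gs >>= remove (gen 𝐲 γ ζ) >>= λ hs → just (∇sᵖ hs one)
num gs (geo  a α β e) = remove (gen a α β) gs >>= λ hs → num hs e
num gs (geo⁺ a α β e) = remove (gen a α β) gs >>= λ hs → Maybe.map (scale 1ℤ (gen a α β)) (num hs e)
num gs (q· e)         = Maybe.map (scale 1ℤ (0 , 0 , 1 , 0)) (num gs e)
num gs (e ∔ e′)       = num gs e >>= λ P → Maybe.map (add P) (num gs e′)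

module _ (ℓ : ℕ → ℕ → ℤ) where

  -- The constant power series 1 seen through `ℓ`; a polynomial applied to it is that polynomial as
  -- a series.
  δ : Series
  δ zero    zero    A B = ℓ A B
  δ zero    (suc m) A B = 0ℤ
  δ (suc k) m       A B = 0ℤ

  ⟦_⟧ : Expr → Series
  ⟦ base α β γ ζ ⟧ k m A B = ℓ (k * α + (m * γ + A)) (k * β + (m * ζ + B))
  ⟦ geo  𝐱 α β e ⟧ k m A B = Σ⟨ k ⟩ (λ u r → ⟦ e ⟧ r m (u * α + A) (u * β + B))
  ⟦ geo  𝐲 α β e ⟧ k m A B = Σ⟨ m ⟩ (λ u r → ⟦ e ⟧ k r (u * α + A) (u * β + B))
  ⟦ geo⁺ 𝐱 α β e ⟧ k m A B = Σ⁺⟨ k ⟩ (λ u r → ⟦ e ⟧ r m (u * α + A) (u * β + B))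
  ⟦ geo⁺ 𝐲 α β e ⟧ k m A B = Σ⁺⟨ m ⟩ (λ u r → ⟦ e ⟧ k r (u * α + A) (u * β + B))
  ⟦ q· e ⟧         k m A B = ⟦ e ⟧ k m (1 + A) B
  ⟦ e ∔ e′ ⟧               = ⟦ e ⟧ ⊞ ⟦ e′ ⟧

  private
    carry : ∀ u α A → u * α + (α + A) ≡ α + u * α + A
    carry = ℕRing.solve-∀

    cancel : ∀ a b → (a ⊕ b) ⊖ b ≡ a
    cancel = ℤRing.solve-∀

  -- Telescoping: the terms with u ≥ 1 in degree k + 1 are the generator times the whole sum in
  -- degree k.
  ∇-geo : ∀ a α β e → ∇ (gen a α β) ⟦ geo a α β e ⟧ ≈ ⟦ e ⟧
  ∇-geo 𝐱 α β e zero    m A B = ℤP.+-identityʳ _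
  ∇-geo 𝐱 α β e (suc k) m A B =
    trans (cong (⟦ geo 𝐱 α β e ⟧ (suc k) m A B ⊖_)
                (Σ-cong k (λ u r _ → cong₂ (⟦ e ⟧ r m) (carry u α A) (carry u β B))))
          (cancel _ (Σ⟨ k ⟩ (λ u r → ⟦ e ⟧ r m (suc u * α + A) (suc u * β + B))))
  ∇-geo 𝐲 α β e k zero    A B = ℤP.+-identityʳ _
  ∇-geo 𝐲 α β e k (suc m) A B =
    trans (cong (⟦ geo 𝐲 α β e ⟧ k (suc m) A B ⊖_)
                (Σ-cong m (λ u r _ → cong₂ (⟦ e ⟧ k r) (carry u α A) (carry u β B))))
          (cancel _ (Σ⟨ m ⟩ (λ u r → ⟦ e ⟧ k r (suc u * α + A) (suc u * β + B))))

  geo⁺-geo : ∀ a α β e → ⟦ geo⁺ a α β e ⟧ ≈ gen a α β ∙ ⟦ geo a α β e ⟧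
  geo⁺-geo 𝐱 α β e zero    m A B = refl
  geo⁺-geo 𝐱 α β e (suc k) m A B =
    trans (ℤP.+-identityˡ _) (Σ-cong k (λ u r _ → sym (cong₂ (⟦ e ⟧ r m) (carry u α A) (carry u β B))))
  geo⁺-geo 𝐲 α β e k zero    A B = refl
  geo⁺-geo 𝐲 α β e k (suc m) A B =
    trans (ℤP.+-identityˡ _) (Σ-cong m (λ u r _ → sym (cong₂ (⟦ e ⟧ k r) (carry u α A) (carry u β B))))

  ∇-geo⁺ : ∀ a α β e → ∇ (gen a α β) ⟦ geo⁺ a α β e ⟧ ≈ gen a α β ∙ ⟦ e ⟧
  ∇-geo⁺ a α β e k m A B =
    trans (∇-cong g (geo⁺-geo a α β e) k m A B)
          (trans (∇-∙ g g ⟦ geo a α β e ⟧ k m A B) (∙-cong g (∇-geo a α β e) k m A B))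
    where g = gen a α β

  ∇-base : ∀ α β γ ζ → ∇ (gen 𝐲 γ ζ) (∇ (gen 𝐱 α β) ⟦ base α β γ ζ ⟧) ≈ δ
  ∇-base α β γ ζ k m A B = trans (∇-cong (gen 𝐲 γ ζ) inner k m A B) (outer k m A B)
    where
    -- What is left of `base` once the x-factor is cleared: the powers of the y-generator alone.
    powers : Series
    powers zero    m A B = ℓ (m * γ + A) (m * ζ + B)
    powers (suc k) m A B = 0ℤ
    move : ∀ k m α γ A → k * α + (m * γ + (α + A)) ≡ α + k * α + (m * γ + A)
    move = ℕRing.solve-∀
    inner : ∇ (gen 𝐱 α β) ⟦ base α β γ ζ ⟧ ≈ powers
    inner zero    m A B = ℤP.+-identityʳ _
    inner (suc k) m A B = trans
      (cong (⟦ base α β γ ζ ⟧ (suc k) m A B ⊖_) (cong₂ ℓ (move k m α γ A) (move k m β ζ B)))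
      (ℤP.+-inverseʳ (⟦ base α β γ ζ ⟧ (suc k) m A B))
    outer : ∇ (gen 𝐲 γ ζ) powers ≈ δ
    outer zero    zero    A B = ℤP.+-identityʳ _
    outer zero    (suc m) A B = trans
      (cong (powers 0 (suc m) A B ⊖_) (cong₂ ℓ (carry m γ A) (carry m ζ B)))
      (ℤP.+-inverseʳ (powers 0 (suc m) A B))
    outer (suc k) zero    A B = refl
    outer (suc k) (suc m) A B = refl

  -- Since the factors commute, the one that belongs to the outermost sum of an expression can be
  -- moved next to it and removes that sum; the remaining factors pass on to the inner expression.
  num-sound : ∀ e gs {P} → num gs e ≡ just P → ∇s gs ⟦ e ⟧ ≈ P ▷ δ
  num-sound (base α β γ ζ) gs eq k m A B with remove (gen 𝐱 α β) gs in eq₁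
  ... | just gs₁ with remove (gen 𝐲 γ ζ) gs₁ in eq₂
  num-sound (base α β γ ζ) gs refl k m A B | just gs₁ | just gs₂ = begin
    ∇s gs F k m A B              ≡⟨ ∇s-remove g gs eq₁ F k m A B ⟩
    ∇s gs₁ (∇ g F) k m A B       ≡⟨ ∇s-remove h gs₁ eq₂ (∇ g F) k m A B ⟩
    ∇s gs₂ (∇ h (∇ g F)) k m A B ≡⟨ ∇s-cong gs₂ (∇-base α β γ ζ) k m A B ⟩
    ∇s gs₂ δ k m A B             ≡⟨ ∇s-cong gs₂ (one-▷ δ) k m A B ⟨
    ∇s gs₂ (one ▷ δ) k m A B     ≡⟨ ∇sᵖ-▷ gs₂ one δ k m A B ⟨
    (∇sᵖ gs₂ one ▷ δ) k m A B    ∎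
    where
    open ≡-Reasoning
    F = ⟦ base α β γ ζ ⟧
    g = gen 𝐱 α β
    h = gen 𝐲 γ ζ
  num-sound (geo a α β e) gs eq k m A B with remove (gen a α β) gs in eq₁
  ... | just hs =
    trans (∇s-remove (gen a α β) gs eq₁ ⟦ geo a α β e ⟧ k m A B)
          (trans (∇s-cong hs (∇-geo a α β e) k m A B) (num-sound e hs eq k m A B))
  num-sound (geo⁺ a α β e) gs eq k m A B with remove (gen a α β) gs in eq₁
  ... | just hs with num hs e in eq₂
  num-sound (geo⁺ a α β e) gs refl k m A B | just hs | just P = begin
    ∇s gs F k m A B              ≡⟨ ∇s-remove g gs eq₁ F k m A B ⟩
    ∇s hs (∇ g F) k m A B        ≡⟨ ∇s-cong hs (∇-geo⁺ a α β e) k m A B ⟩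
    ∇s hs (g ∙ ⟦ e ⟧) k m A B    ≡⟨ ∇s-∙ hs g ⟦ e ⟧ k m A B ⟩
    (g ∙ ∇s hs ⟦ e ⟧) k m A B    ≡⟨ ∙-cong g (num-sound e hs eq₂) k m A B ⟩
    (g ∙ P ▷ δ) k m A B          ≡⟨ scale1-▷ g P δ k m A B ⟨
    (scale 1ℤ g P ▷ δ) k m A B   ∎
    where
    open ≡-Reasoning
    F = ⟦ geo⁺ a α β e ⟧
    g = gen a α β
  num-sound (q· e) gs eq k m A B with num gs e in eq₁
  num-sound (q· e) gs refl k m A B | just P = begin
    ∇s gs (g ∙ ⟦ e ⟧) k m A B    ≡⟨ ∇s-∙ gs g ⟦ e ⟧ k m A B ⟩
    (g ∙ ∇s gs ⟦ e ⟧) k m A B    ≡⟨ ∙-cong g (num-sound e gs eq₁) k m A B ⟩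
    (g ∙ P ▷ δ) k m A B          ≡⟨ scale1-▷ g P δ k m A B ⟨
    (scale 1ℤ g P ▷ δ) k m A B   ∎
    where
    open ≡-Reasoning
    g : Mon
    g = 0 , 0 , 1 , 0
  num-sound (e ∔ e′) gs eq k m A B with num gs e in eq₁
  ... | just P with num gs e′ in eq₂
  num-sound (e ∔ e′) gs refl k m A B | just P | just P′ =
    trans (∇s-⊞ gs ⟦ e ⟧ ⟦ e′ ⟧ k m A B)
          (trans (cong₂ _⊕_ (num-sound e gs eq₁ k m A B) (num-sound e′ gs eq₂ k m A B))
                 (sym (add-▷ P P′ δ k m A B)))

-- Cancellation

-- The generator has degree one in x or y, so the coefficients of `F` are recovered one degree at a
-- time. The induction hypothesis is needed at shifted `A` and `B`, which is why the equality of
-- series is demanded for all of them.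
∇-injective : ∀ a α β {F G} → ∇ (gen a α β) F ≈ ∇ (gen a α β) G → F ≈ G
∇-injective 𝐱 α β {F} {G} eq zero    m A B =
  trans (sym (ℤP.+-identityʳ _)) (trans (eq 0 m A B) (ℤP.+-identityʳ _))
∇-injective 𝐱 α β {F} {G} eq (suc k) m A B =
  ℤGroup.∙-cancelʳ (ℤ.- F k m (α + A) (β + B)) _ _
    (trans (eq (suc k) m A B)
           (cong (λ z → G (suc k) m A B ⊖ z) (sym (∇-injective 𝐱 α β {F} {G} eq k m (α + A) (β + B)))))
∇-injective 𝐲 α β {F} {G} eq k zero    A B =
  trans (sym (ℤP.+-identityʳ _)) (trans (eq k 0 A B) (ℤP.+-identityʳ _))
∇-injective 𝐲 α β {F} {G} eq k (suc m) A B =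
  ℤGroup.∙-cancelʳ (ℤ.- F k m (α + A) (β + B)) _ _
    (trans (eq k (suc m) A B)
           (cong (λ z → G k (suc m) A B ⊖ z) (sym (∇-injective 𝐲 α β {F} {G} eq k m (α + A) (β + B)))))

-- The generating function as a sum of twelve simplicial cones

denomGens extraGens : List (Axis × ℕ × ℕ)
denomGens = (𝐱 , 6 , 0) ∷ (𝐱 , 0 , 6) ∷ (𝐱 , 3 , 1) ∷ (𝐱 , 1 , 3) ∷ (𝐱 , 2 , 2)
          ∷ (𝐲 , 3 , 0) ∷ (𝐲 , 0 , 3) ∷ (𝐲 , 1 , 1) ∷ []
extraGens = (𝐱 , 3 , 3) ∷ (𝐱 , 1 , 4) ∷ (𝐱 , 1 , 5) ∷ (𝐲 , 1 , 2) ∷ []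

mons : List (Axis × ℕ × ℕ) → List Mon
mons []                 = []
mons ((a , α , β) ∷ gs) = gen a α β ∷ mons gs

[1+q] : Expr → Expr
[1+q] e = e ∔ q· e

-- With k = u + e, u = a₁ and N = m + u, the cones eᵃ–eᵈ collect the paths with
-- i₃ ≤ k and eᵉ–eˡ those with i₃ > k.  Inequalities p ≤ m + u are resolved by
-- filling m before u, which is what makes the cones simplicial.
stairs : Expr
stairs = geo 𝐱 3 1 (base 6 0 3 0) ∔ geo⁺ 𝐱 3 1 (q· (base 6 0 3 0) ∔ q· (q· (base 6 0 3 0)))

-- Every variable contributes the generator that records what one more unit of it adds to k or m, to
-- the area and to the bounce. In `eᵈ`, for example, e = v + r + g with d = v + r; for a₂ = 2d the
-- area is u + v + 2r + 3g + m and the bounce 4u + 3v + 2r + g + m, which gives xqt⁴, xqt³, xq²t²,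
-- xq³t and yqt. A factor `[1+q]` stands for a pair of values of a₂ or a₃ with the same bounce.
eᵃ eᵇ eᶜ eᵈ eᵉ eᶠ eᵍ eʰ eⁱ eʲ eᵏ eˡ eᴴ : Expr
eᵃ = geo 𝐱 3 3 (geo 𝐱 2 2 stairs ∔ geo⁺ 𝐱 2 2 (q· (q· (base 6 0 3 0) ∔ stairs)))
eᵇ = geo 𝐱 3 3 (geo 𝐱 2 2 z ∔ geo⁺ 𝐱 2 2 (q· z))
  where z = geo⁺ 𝐲 1 1 ([1+q] (base 3 1 3 0))
eᶜ = geo⁺ 𝐱 1 4 (geo 𝐱 3 3 (geo 𝐱 2 2 z ∔ geo⁺ 𝐱 2 2 (q· z)))
  where z = [1+q] (base 3 1 1 1)
eᵈ = geo 𝐱 1 4 (geo⁺ 𝐱 1 3 (geo 𝐱 2 2 ([1+q] (base 3 1 1 1))))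
eᵉ = geo 𝐱 3 3 (geo⁺ 𝐲 1 2 (geo 𝐲 1 1 z ∔ geo⁺ 𝐲 1 1 (q· z)))
  where z = base 2 2 3 0
eᶠ = geo⁺ 𝐱 1 4 (geo 𝐱 3 3 (geo⁺ 𝐲 1 2 ([1+q] (base 2 2 1 1))))
eᵍ = geo 𝐱 1 4 (geo⁺ 𝐲 0 3 (geo 𝐲 1 2 (base 2 2 1 1)))
eʰ = geo 𝐱 1 4 (geo⁺ 𝐱 1 3 (geo⁺ 𝐲 0 3 (base 2 2 1 1)))
eⁱ = geo⁺ 𝐱 1 5 (geo 𝐱 1 4 z ∔ geo⁺ 𝐱 1 4 (q· z))
  where z = geo 𝐱 3 3 (base 2 2 1 2)
eʲ = geo⁺ 𝐱 1 5 (geo 𝐱 1 4 (geo⁺ 𝐲 0 3 (base 2 2 1 2)))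
eᵏ = geo⁺ 𝐱 0 6 (geo 𝐱 1 5 (geo 𝐱 1 4 (base 2 2 0 3)))
eˡ = geo⁺ 𝐱 0 6 (geo 𝐱 1 4 (geo⁺ 𝐱 1 3 (base 2 2 0 3)))
-- The brackets follow the sums in `grouped-early`, `grouped-late₁` and `grouped-late₂`.
eᴴ = (eᵃ ∔ ((eᵇ ∔ eᶜ) ∔ eᵈ)) ∔ (((eᵉ ∔ eᶠ) ∔ (eᵍ ∔ eʰ)) ∔ (eⁱ ∔ ((eʲ ∔ eᵏ) ∔ eˡ)))

numerator : Poly
numerator = sort (scale -1ℤ (0 , 0 , 0 , 0) M)

-- Verified by evaluation, both sides reducing to sorted lists of terms. That the summed numerators
-- contain the factors of `extraGens` is the cancellation on which the formula rests.
num-eᴴ : num (mons extraGens ++ mons denomGens) eᴴ ≡ just (∇sᵖ (mons extraGens) numerator)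
num-eᴴ = refl

sort-denom : sort denom ≡ ∇sᵖ (mons denomGens) one
sort-denom = refl

-- The bounce path

eastIndex-< : ∀ x A As → x < A → eastIndex x (A ∷ As) ≡ 1
eastIndex-< x A As x<A with x <ᵇ A | ℕP.<⇒<ᵇ x<A
... | true | _ = refl

eastIndex-≥ : ∀ x A As → A ≤ x → eastIndex x (A ∷ As) ≡ suc (eastIndex x As)
eastIndex-≥ x A As A≤x with x <ᵇ A in eq
... | true  = contradiction (ℕP.<ᵇ⇒< x A (subst T (sym eq) tt)) (ℕP.≤⇒≯ A≤x)
... | false = refl

eastIndex-∷ : ∀ x A As → ∃ λ z → eastIndex x (A ∷ As) ≡ suc z
eastIndex-∷ x A As with x <ᵇ A
... | true  = 0 , refl
... | false = eastIndex x As , refl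

active : ℕ → ℕ → ℕ
active c e = if c ≤ᵇ e then 1 else 0

active-≤ : ∀ c e → c ≤ e → active c e ≡ 1
active-≤ c e c≤e with c ≤ᵇ e | ℕP.≤⇒≤ᵇ c≤e
... | true | _ = refl

active-> : ∀ c e → e < c → active c e ≡ 0
active-> c e e<c with c ≤ᵇ e in eq
... | true  = contradiction (ℕP.≤ᵇ⇒≤ c e (subst T (sym eq) tt)) (ℕP.<⇒≱ e<c)
... | false = refl

countAtLeast-++ : ∀ c es es′ → countAtLeast c (es ++ es′) ≡ countAtLeast c es + countAtLeast c es′
countAtLeast-++ c []       es′ = refl
countAtLeast-++ c (e ∷ es) es′ =
  trans (cong (active c e +_) (countAtLeast-++ c es es′)) (sym (ℕP.+-assoc (active c e) _ _))

≡ᵇ-+ : ∀ n k → (n ≡ᵇ suc k + n) ≡ false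
≡ᵇ-+ zero    k = refl
≡ᵇ-+ (suc n) k = subst (λ s → (n ≡ᵇ s) ≡ false) (sym (ℕP.+-suc k n)) (≡ᵇ-+ n k)

module Loop (ks As : List ℕ) (K n : ℕ) where

  loop : ℕ → ℕ → ℕ → ℕ → List ℕ → ℕ
  loop fuel = bounceLoop fuel ks As K n

  wait : ∀ F i x s levels → (s ≡ᵇ n) ≡ false → eastIndex x As ≡ s →
    loop (suc F) i x s levels ≡ loop F (suc i) (x + countAtLeast (suc i) levels) s levels
  wait F i x s levels s≢n east
    rewrite east | s≢n | BoolP.∧-zeroʳ (x ≡ᵇ K) | ℕP.n∸n≡0 s | ℕP.*-zeroʳ i | ListP.++-identityʳ levels = refl

  -- As long as the abscissa stays short of the next column, v is 0 and the bounce gains nothing;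
  -- with a constant number of active columns the motion is then uniform.
  run : ∀ steps h F i x s levels → (s ≡ᵇ n) ≡ false →
    (∀ j → j < steps → eastIndex (x + j * h) As ≡ s) →
    (∀ j → j < steps → countAtLeast (suc (i + j)) levels ≡ h) →
    loop (steps + F) i x s levels ≡ loop F (i + steps) (x + steps * h) s levels
  run zero h F i x s levels s≢n east count =
    cong₂ (λ i x → loop F i x s levels) (sym (ℕP.+-identityʳ i)) (sym (ℕP.+-identityʳ x))
  run (suc steps) h F i x s levels s≢n east count = begin
    loop (suc (steps + F)) i x s levels
      ≡⟨ wait (steps + F) i x s levels s≢n
           (trans (cong (λ y → eastIndex y As) (sym (ℕP.+-identityʳ x))) (east 0 z<s)) ⟩
    loop (steps + F) (suc i) (x + countAtLeast (suc i) levels) s levels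
      ≡⟨ cong (λ h → loop (steps + F) (suc i) (x + h) s levels)
           (trans (cong (λ i → countAtLeast (suc i) levels) (sym (ℕP.+-identityʳ i))) (count 0 z<s)) ⟩
    loop (steps + F) (suc i) (x + h) s levels
      ≡⟨ run steps h F (suc i) (x + h) s levels s≢n
           (λ j j< → trans (cong (λ y → eastIndex y As) (ℕP.+-assoc x h (j * h))) (east (suc j) (s<s j<)))
           (λ j j< → trans (cong (λ i → countAtLeast (suc i) levels) (sym (ℕP.+-suc i j))) (count (suc j) (s<s j<))) ⟩
    loop F (suc i + steps) (x + h + steps * h) s levels
      ≡⟨ cong₂ (λ i x → loop F i x s levels) (sym (ℕP.+-suc i steps)) (ℕP.+-assoc x h (steps * h)) ⟩
    loop F (i + suc steps) (x + suc steps * h) s levels ∎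
    where open ≡-Reasoning

  -- Columns filled in the same iteration may be filled one at a time.
  fill : ∀ F i x s levels k rest z → (s ≡ᵇ n) ≡ false → (suc s ≡ᵇ n) ≡ false →
    eastIndex x As ≡ suc z + s → drop s ks ≡ k ∷ rest → drop (suc s) ks ≡ rest →
    loop (suc F) i x s levels ≡ i + loop (suc F) i x (suc s) (levels ++ (i + k) ∷ [])
  fill F i x s levels k rest z s≢n s+1≢n east eq eq′
    rewrite east | s≢n | s+1≢n | BoolP.∧-zeroʳ (x ≡ᵇ K) | eq | eq′
          | ℕP.m+n∸n≡m (suc z) s | ℕP.m+n∸n≡m z s
          | ListP.++-assoc levels ((i + k) ∷ []) (map (i +_) (take z rest))
          | ℕP.*-suc i z = ℕP.+-assoc i (i * z) _

  -- Once all columns are filled every later v is 0, so the result does not depend on when the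
  -- endpoint test succeeds or the fuel ends.
  finished : ∀ F i x levels → (∀ y → x ≤ y → eastIndex y As ≡ n) → loop F i x n levels ≡ 0
  finished zero    i x levels east = refl
  finished (suc F) i x levels east with (x ≡ᵇ K) ∧ (n ≡ᵇ n)
  ... | true  = refl
  ... | false rewrite east x ℕP.≤-refl | ℕP.n∸n≡0 n | ℕP.*-zeroʳ i =
    finished F (suc i) _ _ (λ y x≤y → east y (ℕP.≤-trans (ℕP.m≤m+n x _) x≤y))

  fillLast : ∀ F i x s levels → suc s ≡ n → (∀ y → x ≤ y → eastIndex y As ≡ n) →
    loop (suc F) i x s levels ≡ i
  fillLast F i x s levels refl east
    rewrite ≡ᵇ-+ s 0 | BoolP.∧-zeroʳ (x ≡ᵇ K) | east x ℕP.≤-refl | ℕP.m+n∸n≡m 1 s =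
    trans (cong₂ _+_ (ℕP.*-identityʳ i)
             (finished F (suc i) _ _ (λ y x≤y → east y (ℕP.≤-trans (ℕP.m≤m+n x _) x≤y))))
          (ℕP.+-identityʳ i)

-- Times are measured from u, the moment the second column starts to move, and
-- abscissae from x = u.  The path runs d steps at speed 2 and p at speed 1
-- before reaching a₂, then c, w, v steps at speeds 3, 2, 1 before reaching T.
record Leg₁ (e N a₂ d p : ℕ) : Set where
  field
    d-before : ∀ j → j < d → j * 2 < a₂
    p-before : ∀ j → j < p → d * 2 + j * 1 < a₂
    reached  : a₂ ≤ d * 2 + p * 1
    d-speed  : d ≤ e
    p-speed  : ∀ j → j < p → e ≤ d + j
    bounded  : d + p ≤ e + N

record Leg₂ (e N X y T c w v : ℕ) : Set where
  field
    c-before : ∀ j → j < c → X + j * 3 < T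
    w-before : ∀ j → j < w → X + (c * 3 + j * 2) < T
    v-before : ∀ j → j < v → X + (c * 3 + (w * 2 + j * 1)) < T
    reached  : T ≤ X + (c * 3 + (w * 2 + v * 1))
    c-speed  : ∀ j → j < c → y + j < e
    w-speed  : ∀ j → j < w → e ≤ y + (c + j)
    w-active : y + (c + w) ≤ e + N
    v-speed  : ∀ j → j < v → e + N ≤ y + (c + (w + j))
    bounded  : c + (w + v) ≤ e + N

-- σ is 1, or 0 when a first north step of length zero has been dropped.
module Legs (u e N σ : ℕ) (ks As levels₀ : List ℕ) (K a₂ a₃ a₄ : ℕ)
  (east   : ∀ x → u ≤ x → eastIndex x As ≡ eastIndex x (u + a₂ ∷ u + a₂ + a₃ ∷ u + a₂ + a₃ + a₄ ∷ []) + σ)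
  (drop₁  : drop (1 + σ) ks ≡ e + N ∷ e + N ∷ [])
  (drop₂  : drop (2 + σ) ks ≡ e + N ∷ [])
  (count₀ : ∀ i → countAtLeast (suc i) levels₀ ≡ active (suc i) (u + e))
  where

  open Loop ks As K (3 + σ)

  A₂ A₃ A₄ : ℕ
  A₂ = u + a₂
  A₃ = A₂ + a₃
  A₄ = A₃ + a₄

  east₁ : ∀ x → u ≤ x → x < A₂ → eastIndex x As ≡ 1 + σ
  east₁ x u≤x x< = trans (east x u≤x) (cong (_+ σ) (eastIndex-< x A₂ (A₃ ∷ A₄ ∷ []) x<))

  past₂ : ∀ x → A₂ ≤ x → eastIndex x As ≡ suc (eastIndex x (A₃ ∷ A₄ ∷ [])) + σ
  past₂ x ≤x = trans (east x (ℕP.≤-trans (ℕP.m≤m+n u a₂) ≤x)) (cong (_+ σ) (eastIndex-≥ x A₂ (A₃ ∷ A₄ ∷ []) ≤x))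

  east₂ : ∀ x → A₂ ≤ x → x < A₃ → eastIndex x As ≡ 2 + σ
  east₂ x ≤x x< = trans (past₂ x ≤x) (cong (λ z → suc z + σ) (eastIndex-< x A₃ (A₄ ∷ []) x<))

  east₃ : ∀ x → A₃ ≤ x → eastIndex x As ≡ 3 + σ
  east₃ x ≤x = trans (past₂ x (ℕP.≤-trans (ℕP.m≤m+n _ a₃) ≤x))
    (cong (λ z → suc z + σ) (trans (eastIndex-≥ x A₃ (A₄ ∷ []) ≤x) (cong suc last)))
    where
    -- Past the last abscissa `eastIndex` falls back on 0 for the empty list, so the index stays at
    -- the last column.
    last : eastIndex x (A₄ ∷ []) ≡ 1
    last with x <ᵇ A₄
    ... | true  = refl
    ... | false = refl

  levels₁ : List ℕ
  levels₁ = levels₀ ++ (u + (e + N)) ∷ []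

  levels₂ : ℕ → List ℕ
  levels₂ y = levels₁ ++ (u + y + (e + N)) ∷ []

  count₁ : ∀ i → countAtLeast (suc i) levels₁ ≡ active (suc i) (u + e) + (active (suc i) (u + (e + N)) + 0)
  count₁ i = trans (countAtLeast-++ (suc i) levels₀ _) (cong (_+ (active (suc i) (u + (e + N)) + 0)) (count₀ i))

  count₂ : ∀ y i → countAtLeast (suc i) (levels₂ y) ≡
    active (suc i) (u + e) + (active (suc i) (u + (e + N)) + 0) + (active (suc i) (u + y + (e + N)) + 0)
  count₂ y i = trans (countAtLeast-++ (suc i) levels₁ _) (cong (_+ (active (suc i) (u + y + (e + N)) + 0)) (count₁ i))

  active-<′ : ∀ {y z i} → i ≡ u + y → y < z → active (suc i) (u + z) ≡ 1
  active-<′ {y} {z} refl y<z = active-≤ _ _ (subst (_≤ u + z) (ℕP.+-suc u y) (ℕP.+-monoʳ-≤ u y<z))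

  active-≥′ : ∀ {y z i} → i ≡ u + y → z ≤ y → active (suc i) (u + z) ≡ 0
  active-≥′ {y} {z} refl z≤y = active-> _ _ (s≤s (ℕP.+-monoʳ-≤ u z≤y))

  active-last : ∀ {y z i} → i ≡ u + y + z → z < e + N → active (suc i) (u + y + (e + N)) ≡ 1
  active-last {y} {z} refl z< =
    active-≤ _ _ (subst (_≤ u + y + (e + N)) (ℕP.+-suc (u + y) z) (ℕP.+-monoʳ-≤ (u + y) z<))

  module _ {d p c w v : ℕ} (leg₁ : Leg₁ e N a₂ d p)
           (leg₂ : Leg₂ e N (d * 2 + p * 1) (d + p) (a₂ + a₃) c w v) where
    private
      module L₁ = Leg₁ leg₁
      module L₂ = Leg₂ leg₂
      y x₃ : ℕ
      y  = d + p
      x₃ = d * 2 + p * 1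

    <-shift : ∀ {x z t} → x ≡ u + z → z < t → x < u + t
    <-shift refl = ℕP.+-monoʳ-< u

    <-shift₃ : ∀ {x z} → x ≡ u + z → z < a₂ + a₃ → x < A₃
    <-shift₃ {x} eq z< = subst (x <_) (sym (ℕP.+-assoc u a₂ a₃)) (<-shift eq z<)

    before : ∀ F → loop (d + (p + suc F)) u u (1 + σ) levels₁ ≡ u + y + loop (suc F) (u + y) (u + x₃) (2 + σ) (levels₂ y)
    before F = begin
      loop (d + (p + suc F)) u u (1 + σ) levels₁
        ≡⟨ run d 2 (p + suc F) u u (1 + σ) levels₁ (≡ᵇ-+ σ 1)
             (λ j j< → east₁ _ (ℕP.m≤m+n u _) (ℕP.+-monoʳ-< u (L₁.d-before j j<)))
             (λ j j< → trans (count₁ (u + j)) (cong₂ (λ a b → a + (b + 0))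
               (active-<′ refl (ℕP.<-≤-trans j< L₁.d-speed))
               (active-<′ refl (ℕP.<-≤-trans j< (ℕP.≤-trans L₁.d-speed (ℕP.m≤m+n e N)))))) ⟩
      loop (p + suc F) (u + d) (u + d * 2) (1 + σ) levels₁
        ≡⟨ run p 1 (suc F) (u + d) (u + d * 2) (1 + σ) levels₁ (≡ᵇ-+ σ 1)
             (λ j j< → east₁ _ (ℕP.≤-trans (ℕP.m≤m+n u _) (ℕP.m≤m+n _ _)) (<-shift (ℕP.+-assoc u _ _) (L₁.p-before j j<)))
             (λ j j< → trans (count₁ (u + d + j)) (cong₂ (λ a b → a + (b + 0))
               (active-≥′ (ℕP.+-assoc u d j) (L₁.p-speed j j<))
               (active-<′ (ℕP.+-assoc u d j) (ℕP.<-≤-trans (ℕP.+-monoʳ-< d j<) L₁.bounded)))) ⟩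
      loop (suc F) (u + d + p) (u + d * 2 + p * 1) (1 + σ) levels₁
        ≡⟨ cong₂ (λ i x → loop (suc F) i x (1 + σ) levels₁) (ℕP.+-assoc u d p) (ℕP.+-assoc u (d * 2) (p * 1)) ⟩
      loop (suc F) (u + y) (u + x₃) (1 + σ) levels₁
        -- It stays open here whether the last column is filled in the same iteration: `next` only
        -- supplies the number of further columns, which is nonzero when a₃ needs no step of its
        -- own.
        ≡⟨ fill F (u + y) (u + x₃) (1 + σ) levels₁ (e + N) (e + N ∷ []) (proj₁ next) (≡ᵇ-+ σ 1) (≡ᵇ-+ σ 0)
             (trans (past₂ (u + x₃) (ℕP.+-monoʳ-≤ u L₁.reached)) (trans (cong (λ z → suc z + σ) (proj₂ next)) (cong suc (sym (ℕP.+-suc (proj₁ next) σ)))))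
             drop₁ drop₂ ⟩
      u + y + loop (suc F) (u + y) (u + x₃) (2 + σ) (levels₂ y) ∎
      where
      open ≡-Reasoning
      next = eastIndex-∷ (u + x₃) (A₃) (A₄ ∷ [])

    after : ∀ F → loop (c + (w + (v + suc F))) (u + y) (u + x₃) (2 + σ) (levels₂ y) ≡ u + y + c + w + v
    after F = begin
      loop (c + (w + (v + suc F))) (u + y) (u + x₃) (2 + σ) (levels₂ y)
        ≡⟨ run c 3 (w + (v + suc F)) (u + y) (u + x₃) (2 + σ) (levels₂ y) (≡ᵇ-+ σ 0)
             (λ j j< → east₂ _ (above (ℕP.m≤m+n _ _)) (<-shift₃ (ℕP.+-assoc u x₃ (j * 3)) (L₂.c-before j j<)))
             (λ j j< → trans (count₂ y (u + y + j)) (cong₂ _+_ (cong₂ (λ a b → a + (b + 0))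
               (active-<′ (ℕP.+-assoc u y j) (L₂.c-speed j j<))
               (active-<′ (ℕP.+-assoc u y j) (ℕP.<-≤-trans (L₂.c-speed j j<) (ℕP.m≤m+n e N))))
               (cong (_+ 0) (active-last {y} {j} refl (ℕP.<-≤-trans j< (ℕP.≤-trans (ℕP.m≤m+n c _) L₂.bounded)))))) ⟩
      loop (w + (v + suc F)) (u + y + c) (u + x₃ + c * 3) (2 + σ) (levels₂ y)
        ≡⟨ run w 2 (v + suc F) (u + y + c) (u + x₃ + c * 3) (2 + σ) (levels₂ y) (≡ᵇ-+ σ 0)
             (λ j j< → east₂ _ (above (ℕP.≤-trans (ℕP.m≤m+n _ _) (ℕP.m≤m+n _ _)))
               (<-shift₃ (assoc₄ u x₃ (c * 3) (j * 2)) (L₂.w-before j j<)))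
             (λ j j< → trans (count₂ y (u + y + c + j)) (cong₂ _+_ (cong₂ (λ a b → a + (b + 0))
               (active-≥′ (assoc₄ u y c j) (L₂.w-speed j j<))
               (active-<′ (assoc₄ u y c j) (ℕP.<-≤-trans (ℕP.+-monoʳ-< y (ℕP.+-monoʳ-< c j<)) L₂.w-active)))
               (cong (_+ 0) (active-last {y} {c + j} (ℕP.+-assoc (u + y) c j)
                 (ℕP.<-≤-trans (ℕP.+-monoʳ-< c (ℕP.<-≤-trans j< (ℕP.m≤m+n w v))) L₂.bounded))))) ⟩
      loop (v + suc F) (u + y + c + w) (u + x₃ + c * 3 + w * 2) (2 + σ) (levels₂ y)
        ≡⟨ run v 1 (suc F) (u + y + c + w) (u + x₃ + c * 3 + w * 2) (2 + σ) (levels₂ y) (≡ᵇ-+ σ 0)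
             (λ j j< → east₂ _ (above (ℕP.≤-trans (ℕP.m≤m+n _ _) (ℕP.≤-trans (ℕP.m≤m+n _ _) (ℕP.m≤m+n _ _))))
               (<-shift₃ (assoc₅ u x₃ (c * 3) (w * 2) (j * 1)) (L₂.v-before j j<)))
             (λ j j< → trans (count₂ y (u + y + c + w + j)) (cong₂ _+_ (cong₂ (λ a b → a + (b + 0))
               (active-≥′ (assoc₅ u y c w j) (ℕP.≤-trans (ℕP.m≤m+n e N) (L₂.v-speed j j<)))
               (active-≥′ (assoc₅ u y c w j) (L₂.v-speed j j<)))
               (cong (_+ 0) (active-last {y} {c + (w + j)} (assoc₄ (u + y) c w j)
                 (ℕP.<-≤-trans (ℕP.+-monoʳ-< c (ℕP.+-monoʳ-< w j<)) L₂.bounded))))) ⟩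
      loop (suc F) (u + y + c + w + v) (u + x₃ + c * 3 + w * 2 + v * 1) (2 + σ) (levels₂ y)
        ≡⟨ fillLast F _ _ (2 + σ) (levels₂ y) refl (λ z ≤z → east₃ z (ℕP.≤-trans final ≤z)) ⟩
      u + y + c + w + v ∎
      where
      open ≡-Reasoning
      assoc₄ : ∀ a b c d → a + b + c + d ≡ a + (b + (c + d))
      assoc₄ = ℕRing.solve-∀
      assoc₅ : ∀ a b c d e → a + b + c + d + e ≡ a + (b + (c + (d + e)))
      assoc₅ = ℕRing.solve-∀
      above : ∀ {x} → u + x₃ ≤ x → A₂ ≤ x
      above = ℕP.≤-trans (ℕP.+-monoʳ-≤ u L₁.reached)
      final : A₃ ≤ u + x₃ + c * 3 + w * 2 + v * 1
      final = subst₂ _≤_ (sym (ℕP.+-assoc u a₂ a₃)) (sym (assoc₅ u x₃ _ _ _)) (ℕP.+-monoʳ-≤ u L₂.reached)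

    legs : ∀ F → loop (d + (p + (c + (w + (v + suc F))))) u u (1 + σ) levels₁ ≡
           (u + y) + (u + y + c + w + v)
    legs F = begin
      loop (d + (p + (c + (w + (v + suc F))))) u u (1 + σ) levels₁
        ≡⟨ cong (λ F → loop (d + (p + F)) u u (1 + σ) levels₁) (fuel c w v F) ⟩
      loop (d + (p + suc (c + (w + (v + F))))) u u (1 + σ) levels₁
        ≡⟨ before (c + (w + (v + F))) ⟩
      u + y + loop (suc (c + (w + (v + F)))) (u + y) (u + x₃) (2 + σ) (levels₂ y)
        ≡⟨ cong (λ F → u + y + loop F (u + y) (u + x₃) (2 + σ) (levels₂ y)) (fuel c w v F) ⟨
      u + y + loop (c + (w + (v + suc F))) (u + y) (u + x₃) (2 + σ) (levels₂ y)
        ≡⟨ cong (u + y +_) (after F) ⟩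
      (u + y) + (u + y + c + w + v) ∎
      where
      open ≡-Reasoning
      fuel : ∀ c w v F → c + (w + (v + suc F)) ≡ suc (c + (w + (v + F)))
      fuel = ℕRing.solve-∀

-- The bounce statistic from the step counts of the two legs

BounceSpec : (u e N : ℕ) → (ℕ → ℕ → ℕ → ℕ) → Set
BounceSpec u e N b = ∀ {a₂ a₃ a₄ d p c w v} → Leg₁ e N a₂ d p →
  Leg₂ e N (d * 2 + p * 1) (d + p) (a₂ + a₃) c w v →
  b a₂ a₃ a₄ ≡ u + ((u + (d + p)) + (u + (d + p) + c + w + v))

-- `run` takes its steps off fuel that is written as a sum. One unit stays behind for the iteration
-- that fills the last column.
fuel-split : ∀ {u S d p c w v} → u + ((d + p) + (c + (w + v))) ≤ S →
  ∃ λ F → suc S ≡ u + (d + (p + (c + (w + (v + suc F)))))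
fuel-split {u} {S} {d} {p} {c} {w} {v} n≤S = S ∸ n , (begin
  suc S             ≡⟨ cong suc (ℕP.m+[n∸m]≡n n≤S) ⟨
  suc (n + (S ∸ n)) ≡⟨ lemma u d p c w v (S ∸ n) ⟩
  u + (d + (p + (c + (w + (v + suc (S ∸ n)))))) ∎)
  where
  open ≡-Reasoning
  n = u + ((d + p) + (c + (w + v)))
  lemma : ∀ u d p c w v F → suc (u + ((d + p) + (c + (w + v))) + F) ≡ u + (d + (p + (c + (w + (v + suc F)))))
  lemma = ℕRing.solve-∀

bounce₄ : ∀ u e N → BounceSpec u e N (λ a₂ a₃ a₄ →
  bounce (u + e ∷ e + N ∷ e + N ∷ e + N ∷ []) (u ∷ a₂ ∷ a₃ ∷ a₄ ∷ []))
bounce₄ u e N {a₂} {a₃} {a₄} {d} {p} {c} {w} {v} leg₁ leg₂ = begin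
  loop (suc S) 0 0 0 []
    ≡⟨ fill S 0 0 0 [] (u + e) _ (proj₁ first) refl refl (trans (proj₂ first) (sym (ℕP.+-identityʳ _))) refl refl ⟩
  loop (suc S) 0 0 1 (u + e ∷ [])
    ≡⟨ cong (λ F → loop F 0 0 1 (u + e ∷ [])) (proj₂ fuel) ⟩
  loop (u + (d + (p + (c + (w + (v + suc F)))))) 0 0 1 (u + e ∷ [])
    ≡⟨ cong (λ F → loop (u + F) 0 0 1 (u + e ∷ [])) (sucs d p c w v F) ⟩
  loop (u + suc (d + (p + (c + (w + (v + F)))))) 0 0 1 (u + e ∷ [])
    ≡⟨ run u 1 (suc (d + (p + (c + (w + (v + F)))))) 0 0 1 (u + e ∷ []) refl
         (λ j j< → eastIndex-< _ u (u + a₂ ∷ u + a₂ + a₃ ∷ u + a₂ + a₃ + a₄ ∷ []) (subst (_< u) (sym (ℕP.*-identityʳ j)) j<))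
         (λ j j< → trans (ℕP.+-identityʳ _) (active-≤ (suc j) (u + e) (ℕP.≤-trans j< (ℕP.m≤m+n u e)))) ⟩
  loop (suc (d + (p + (c + (w + (v + F)))))) u (u * 1) 1 (u + e ∷ [])
    ≡⟨ cong (λ x → loop (suc (d + (p + (c + (w + (v + F)))))) u x 1 (u + e ∷ [])) (ℕP.*-identityʳ u) ⟩
  loop (suc (d + (p + (c + (w + (v + F)))))) u u 1 (u + e ∷ [])
    ≡⟨ fill (d + (p + (c + (w + (v + F))))) u u 1 (u + e ∷ []) (e + N) _ (proj₁ second) refl refl
         (trans (east u ℕP.≤-refl) (cong (_+ 1) (proj₂ second))) refl refl ⟩
  u + loop (suc (d + (p + (c + (w + (v + F)))))) u u 2 (u + e ∷ u + (e + N) ∷ [])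
    ≡⟨ cong (λ F → u + loop F u u 2 (u + e ∷ u + (e + N) ∷ [])) (sucs d p c w v F) ⟨
  u + loop (d + (p + (c + (w + (v + suc F))))) u u 2 (u + e ∷ u + (e + N) ∷ [])
    ≡⟨ cong (u +_) (Legs.legs u e N 1 ks As (u + e ∷ []) (sum ks) a₂ a₃ a₄ east refl refl
         (λ i → ℕP.+-identityʳ _) leg₁ leg₂ F) ⟩
  u + ((u + (d + p)) + (u + (d + p) + c + w + v)) ∎
  where
  open ≡-Reasoning
  ks = u + e ∷ e + N ∷ e + N ∷ e + N ∷ []
  As = u ∷ u + a₂ ∷ u + a₂ + a₃ ∷ u + a₂ + a₃ + a₄ ∷ []
  S = sum ks + 4
  open Loop ks As (sum ks) 4
  first = eastIndex-∷ 0 u (u + a₂ ∷ u + a₂ + a₃ ∷ u + a₂ + a₃ + a₄ ∷ [])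
  second = eastIndex-∷ u (u + a₂) (u + a₂ + a₃ ∷ u + a₂ + a₃ + a₄ ∷ [])
  east : ∀ x → u ≤ x → eastIndex x As ≡ eastIndex x (u + a₂ ∷ u + a₂ + a₃ ∷ u + a₂ + a₃ + a₄ ∷ []) + 1
  east x u≤x = trans (eastIndex-≥ x u (u + a₂ ∷ u + a₂ + a₃ ∷ u + a₂ + a₃ + a₄ ∷ []) u≤x) (sym (ℕP.+-comm _ 1))
  bound : ∀ u e L → u + (L + L) + (e + (L + 4)) ≡ u + e + (L + (L + (L + 0))) + 4
  bound = ℕRing.solve-∀
  -- Each of the two legs lasts at most e + N steps, the lifetime of the column that was filled when
  -- it began.
  fuel = fuel-split {u} {S} {d} {p} {c} {w} {v}
    (ℕP.≤-trans (ℕP.+-monoʳ-≤ u (ℕP.+-mono-≤ (Leg₁.bounded leg₁) (Leg₂.bounded leg₂)))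
      (subst (u + (e + N + (e + N)) ≤_) (bound u e (e + N)) (ℕP.m≤m+n _ _)))
  F = proj₁ fuel
  sucs : ∀ d p c w v F → d + (p + (c + (w + (v + suc F)))) ≡ suc (d + (p + (c + (w + (v + F)))))
  sucs = ℕRing.solve-∀

bounce₃ : ∀ N → BounceSpec 0 0 N (λ a₂ a₃ a₄ → bounce (N ∷ N ∷ N ∷ []) (a₂ ∷ a₃ ∷ a₄ ∷ []))
bounce₃ N {a₂} {a₃} {a₄} {d} {p} {c} {w} {v} leg₁ leg₂ = begin
  loop (suc S) 0 0 0 []
    ≡⟨ fill S 0 0 0 [] N _ (proj₁ first) refl refl (trans (proj₂ first) (sym (ℕP.+-identityʳ _))) refl refl ⟩
  loop (suc S) 0 0 1 (N ∷ [])
    ≡⟨ cong (λ F → loop F 0 0 1 (N ∷ [])) (proj₂ fuel) ⟩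
  loop (d + (p + (c + (w + (v + suc F))))) 0 0 1 (N ∷ [])
    -- The dropped first column behaves like one with bottom entry 0, which is never active.
    ≡⟨ Legs.legs 0 0 N 0 ks As [] (sum ks) a₂ a₃ a₄ (λ x _ → sym (ℕP.+-identityʳ _)) refl refl
         (λ i → refl) leg₁ leg₂ F ⟩
  (d + p) + ((d + p) + c + w + v) ∎
  where
  open ≡-Reasoning
  ks = N ∷ N ∷ N ∷ []
  As = a₂ ∷ a₂ + a₃ ∷ a₂ + a₃ + a₄ ∷ []
  S = sum ks + 3
  open Loop ks As (sum ks) 3
  first = eastIndex-∷ 0 a₂ (a₂ + a₃ ∷ a₂ + a₃ + a₄ ∷ [])
  bound : ∀ L → L + L + (L + 3) ≡ L + (L + (L + 0)) + 3
  bound = ℕRing.solve-∀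
  fuel = fuel-split {0} {S} {d} {p} {c} {w} {v}
    (ℕP.≤-trans (ℕP.+-mono-≤ (Leg₁.bounded leg₁) (Leg₂.bounded leg₂))
      (subst (N + N ≤_) (bound N) (ℕP.m≤m+n _ _)))
  F = proj₁ fuel

-- Step counts on the ranges of a₂ and a₃

*-before : ∀ x {h n τ} → x + n * suc h ≤ τ → ∀ j → j < n → x + j * suc h < τ
*-before x {h} n≤ j j<n = ℕP.<-≤-trans (ℕP.+-monoʳ-< x (ℕP.*-monoˡ-< (suc h) j<n)) n≤

suc-before : ∀ x {h n τ} → x + n * suc h < τ → ∀ j → j < suc n → x + j * suc h < τ
suc-before x {h} n< j j≤n = ℕP.≤-<-trans (ℕP.+-monoʳ-≤ x (ℕP.*-monoˡ-≤ (suc h) (ℕP.≤-pred j≤n))) n<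

leg₁-d : ∀ {N} d g → Leg₁ (d + g) N (d * 2) d 0
leg₁-d {N} d g = record
  { d-before = *-before 0 ℕP.≤-refl
  ; p-before = λ _ ()
  ; reached  = ℕP.m≤m+n _ _
  ; d-speed  = ℕP.m≤m+n d g
  ; p-speed  = λ _ ()
  ; bounded  = subst (_≤ d + g + N) (sym (ℕP.+-identityʳ d)) (ℕP.≤-trans (ℕP.m≤m+n d g) (ℕP.m≤m+n _ N))
  }

-- The odd distance 2d + 1 takes as many steps as 2d + 2; the last step overshoots by one.
leg₁-d′ : ∀ {N} d g → Leg₁ (suc d + g) N (suc (d * 2)) (suc d) 0
leg₁-d′ {N} d g = record
  { d-before = suc-before 0 ℕP.≤-refl
  ; p-before = λ _ ()
  ; reached  = s≤s (ℕP.m≤n⇒m≤1+n (ℕP.m≤m+n _ _))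
  ; d-speed  = ℕP.m≤m+n (suc d) g
  ; p-speed  = λ _ ()
  ; bounded  = subst (_≤ suc d + g + N) (sym (ℕP.+-identityʳ (suc d))) (ℕP.≤-trans (ℕP.m≤m+n (suc d) g) (ℕP.m≤m+n _ N))
  }

leg₁-p : ∀ e p r → Leg₁ e (p + r) (e * 2 + p) e p
leg₁-p e p r = record
  { d-before = *-before 0 (ℕP.m≤m+n (e * 2) p)
  ; p-before = *-before (e * 2) (ℕP.≤-reflexive (cong (e * 2 +_) (ℕP.*-identityʳ p)))
  ; reached  = ℕP.≤-reflexive (cong (e * 2 +_) (sym (ℕP.*-identityʳ p)))
  ; d-speed  = ℕP.≤-refl
  ; p-speed  = λ j _ → ℕP.m≤m+n e j
  ; bounded  = ℕP.+-monoʳ-≤ e (ℕP.m≤m+n p r)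
  }

module _ {e N X y : ℕ} where

  leg₂-0 : ∀ {T} → T ≤ X → y ≤ e + N → Leg₂ e N X y T 0 0 0
  leg₂-0 T≤X y≤ = record
    { c-before = λ _ ()
    ; w-before = λ _ ()
    ; v-before = λ _ ()
    ; reached  = subst (_ ≤_) (sym (ℕP.+-identityʳ X)) T≤X
    ; c-speed  = λ _ ()
    ; w-speed  = λ _ ()
    ; w-active = subst (_≤ e + N) (sym (ℕP.+-identityʳ y)) y≤
    ; v-speed  = λ _ ()
    ; bounded  = z≤n
    }

  leg₂-c : ∀ {T} c {τ} → T ≡ X + τ → y + suc c ≤ e → c * 3 < τ → τ ≤ suc c * 3 → Leg₂ e N X y T (suc c) 0 0
  leg₂-c c refl c≤ <τ τ≤ = record
    { c-before = λ j j< → ℕP.+-monoʳ-< X (suc-before 0 <τ j j<)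
    ; w-before = λ _ ()
    ; v-before = λ _ ()
    ; reached  = ℕP.+-monoʳ-≤ X (ℕP.≤-trans τ≤ (ℕP.m≤m+n _ 0))
    ; c-speed  = λ j j< → ℕP.<-≤-trans (ℕP.+-monoʳ-< y j<) c≤
    ; w-speed  = λ _ ()
    ; w-active = subst (λ z → y + z ≤ e + N) (sym (ℕP.+-identityʳ (suc c))) (ℕP.≤-trans c≤ (ℕP.m≤m+n e N))
    ; v-speed  = λ _ ()
    ; bounded  = ℕP.≤-trans (subst (_≤ y + suc c) (sym (ℕP.+-identityʳ (suc c))) (ℕP.m≤n+m _ y)) (ℕP.≤-trans c≤ (ℕP.m≤m+n e N))
    }

  leg₂-w : ∀ {T} c w {τ} → T ≡ X + τ → (∀ j → j < c → y + j < e) → e ≤ y + c → y + (c + suc w) ≤ e + N →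
    c * 3 + w * 2 < τ → τ ≤ c * 3 + suc w * 2 → Leg₂ e N X y T c (suc w) 0
  leg₂-w c w refl c-speed ≤c w≤ <τ τ≤ = record
    { c-before = λ j j< → ℕP.+-monoʳ-< X (*-before 0 (ℕP.≤-trans (ℕP.m≤m+n _ _) (ℕP.<⇒≤ <τ)) j j<)
    ; w-before = λ j j< → ℕP.+-monoʳ-< X (suc-before (c * 3) <τ j j<)
    ; v-before = λ _ ()
    ; reached  = ℕP.+-monoʳ-≤ X (ℕP.≤-trans τ≤ (ℕP.+-monoʳ-≤ (c * 3) (ℕP.m≤m+n _ 0)))
    ; c-speed  = c-speed
    ; w-speed  = λ j _ → ℕP.≤-trans ≤c (ℕP.+-monoʳ-≤ y (ℕP.m≤m+n c j))
    ; w-active = w≤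
    ; v-speed  = λ _ ()
    ; bounded  = ℕP.≤-trans (subst (λ z → c + z ≤ y + (c + suc w)) (sym (ℕP.+-identityʳ (suc w))) (ℕP.m≤n+m _ y)) w≤
    }

  leg₂-v : ∀ {T} c w v {τ} → T ≡ X + τ → (∀ j → j < c → y + j < e) → e ≤ y + c → y + (c + w) ≡ e + N →
    c + (w + v) ≤ e + N → τ ≡ c * 3 + (w * 2 + v) → Leg₂ e N X y T c w v
  leg₂-v c w v refl c-speed ≤c w≡ v≤ refl = record
    { c-before = λ j j< → ℕP.+-monoʳ-< X (*-before 0 (ℕP.m≤m+n (c * 3) _) j j<)
    ; w-before = λ j j< → ℕP.+-monoʳ-< X (*-before (c * 3) (ℕP.+-monoʳ-≤ (c * 3) (ℕP.m≤m+n (w * 2) v)) j j<)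
    ; v-before = λ j j< → ℕP.+-monoʳ-< X (ℕP.+-monoʳ-< (c * 3) (ℕP.+-monoʳ-< (w * 2) (subst (_< v) (sym (ℕP.*-identityʳ j)) j<)))
    ; reached  = ℕP.≤-reflexive (cong (λ v → X + (c * 3 + (w * 2 + v))) (sym (ℕP.*-identityʳ v)))
    ; c-speed  = c-speed
    ; w-speed  = λ j _ → ℕP.≤-trans ≤c (ℕP.+-monoʳ-≤ y (ℕP.m≤m+n c j))
    ; w-active = ℕP.≤-reflexive w≡
    ; v-speed  = λ j _ → subst (_≤ y + (c + (w + j))) w≡ (ℕP.+-monoʳ-≤ y (ℕP.+-monoʳ-≤ c (ℕP.m≤m+n w j)))
    ; bounded  = v≤
    }

-- Grouping the paths by the times at which their columns start to move

-- The cut is where the speed drops from 2 to 1: below it the values 2c - 1 and 2c share the step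
-- count c, with 0 alone at c = 0, and beyond it every value has its own. This serves for a₂ and,
-- once the first column is exhausted, for a₃.
Σ-multiples : ∀ g h f → Σ⟨ g * 2 + h ⟩ f ≡
  (Σ⟨ g ⟩ (λ c r → f (c * 2) (r * 2 + h)) ⊕ Σ⁺⟨ g ⟩ (λ c r → f (c * 2 ∸ 1) (1 + r * 2 + h)))
  ⊕ Σ⁺⟨ h ⟩ (λ v r → f (g * 2 + v) r)
Σ-multiples g h f = trans (Σ-split (g * 2) h f) (cong (_⊕ Σ⁺⟨ h ⟩ (λ v r → f (g * 2 + v) r)) (begin
  Σ⟨ g * 2 ⟩ (λ a r → f a (r + h))
    ≡⟨ Σ⁺-first (g * 2) _ ⟩
  f 0 (g * 2 + h) ⊕ Σ⁺⟨ g * 2 ⟩ (λ a r → f a (r + h))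
    ≡⟨ cong (f 0 (g * 2 + h) ⊕_) (trans (Σ⁺-pairs g _) (Σ⁺-+ g _ _)) ⟩
  f 0 (g * 2 + h) ⊕ (Σ⁺⟨ g ⟩ (λ c r → f (c * 2) (r * 2 + h)) ⊕ Σ⁺⟨ g ⟩ (λ c r → f (c * 2 ∸ 1) (1 + r * 2 + h)))
    ≡⟨ ℤP.+-assoc (f 0 (g * 2 + h)) _ _ ⟨
  f 0 (g * 2 + h) ⊕ Σ⁺⟨ g ⟩ (λ c r → f (c * 2) (r * 2 + h)) ⊕ Σ⁺⟨ g ⟩ (λ c r → f (c * 2 ∸ 1) (1 + r * 2 + h))
    ≡⟨ cong (_⊕ Σ⁺⟨ g ⟩ (λ c r → f (c * 2 ∸ 1) (1 + r * 2 + h))) (Σ⁺-first g _) ⟨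
  Σ⟨ g ⟩ (λ c r → f (c * 2) (r * 2 + h)) ⊕ Σ⁺⟨ g ⟩ (λ c r → f (c * 2 ∸ 1) (1 + r * 2 + h)) ∎))
  where open ≡-Reasoning

-- The range of a₃ is cut where the speed drops: 3g is covered at speed 3, the next 2N at speed 2,
-- the last h at speed 1. In each group the lower values take as many steps as the top one but leave
-- a larger rank r₄.
Σ-legs : ∀ g N h f → Σ⟨ g * 3 + (N * 2 + h) ⟩ f ≡
  (Σ⟨ g ⟩ (λ c r → f (c * 3) (r * 3 + (N * 2 + h)))
    ⊕ Σ⁺⟨ g ⟩ (λ c r → f (c * 3 ∸ 1) (1 + r * 3 + (N * 2 + h)) ⊕ f (c * 3 ∸ 2) (2 + r * 3 + (N * 2 + h))))
  ⊕ (Σ⁺⟨ N ⟩ (λ w r → f (g * 3 + w * 2) (r * 2 + h) ⊕ f (g * 3 + (w * 2 ∸ 1)) (1 + r * 2 + h))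
    ⊕ Σ⁺⟨ h ⟩ (λ v r → f (g * 3 + (N * 2 + v)) r))
Σ-legs g N h f = trans (Σ-split (g * 3) (N * 2 + h) f) (cong₂ _⊕_ triples
  (trans (Σ⁺-split (N * 2) h _) (cong (_⊕ Σ⁺⟨ h ⟩ (λ v r → f (g * 3 + (N * 2 + v)) r)) (Σ⁺-pairs N _))))
  where
  open ≡-Reasoning
  h′ = N * 2 + h
  F₀ F₁ : ℕ → ℕ → ℤ
  F₀ c r = f (c * 3) (r * 3 + h′)
  F₁ c r = f (c * 3 ∸ 1) (1 + r * 3 + h′) ⊕ f (c * 3 ∸ 2) (2 + r * 3 + h′)
  triples : Σ⟨ g * 3 ⟩ (λ a r → f a (r + h′)) ≡ Σ⟨ g ⟩ F₀ ⊕ Σ⁺⟨ g ⟩ F₁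
  triples = begin
    Σ⟨ g * 3 ⟩ (λ a r → f a (r + h′))
      ≡⟨ Σ⁺-first (g * 3) _ ⟩
    F₀ 0 g ⊕ Σ⁺⟨ g * 3 ⟩ (λ a r → f a (r + h′))
      ≡⟨ cong (F₀ 0 g ⊕_) (trans (Σ⁺-triples g _) (Σ⁺-+ g F₀ F₁)) ⟩
    F₀ 0 g ⊕ (Σ⁺⟨ g ⟩ F₀ ⊕ Σ⁺⟨ g ⟩ F₁)
      ≡⟨ ℤP.+-assoc (F₀ 0 g) _ _ ⟨
    F₀ 0 g ⊕ Σ⁺⟨ g ⟩ F₀ ⊕ Σ⁺⟨ g ⟩ F₁
      ≡⟨ cong (_⊕ Σ⁺⟨ g ⟩ F₁) (Σ⁺-first g F₀) ⟨
    Σ⟨ g ⟩ F₀ ⊕ Σ⁺⟨ g ⟩ F₁ ∎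

module Grouped (ℓ : ℕ → ℕ → ℤ) (u A B : ℕ) where

  -- The first argument of `ℓ` is the area r₂ + r₃ + r₄ with r₂ = e, the second the bounce i₂ + i₃ +
  -- i₄ with i₂ = u, i₃ = u + y and i₄ = u + y + c + w + v.
  τ : (e r₃ r₄ y c w v : ℕ) → ℤ
  τ e r₃ r₄ y c w v = ℓ (e + (r₃ + (r₄ + 0)) + A) (u + ((u + y) + (u + y + c + w + v)) + B)

  -- early: i₃ ≤ k, late: i₃ > k; C, W, V: a₃ is reached at speed 3, 2, 1.
  earlyC : (d g N r₃ : ℕ) → ℤ
  earlyC d g N r₃ =
    Σ⟨ g ⟩ (λ c r → t (r * 3 + (N * 2 + d)) c)
      ⊕ Σ⁺⟨ g ⟩ (λ c r → t (1 + r * 3 + (N * 2 + d)) c ⊕ t (2 + r * 3 + (N * 2 + d)) c)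
    where t = λ r₄ c → τ (d + g) r₃ r₄ (d + 0) c 0 0

  earlyW : (d g r₃ w r : ℕ) → ℤ
  earlyW d g r₃ w r = t (r * 2 + d) ⊕ t (1 + r * 2 + d)
    where t = λ r₄ → τ (d + g) r₃ r₄ (d + 0) g w 0

  earlyV : (d g N r₃ v r : ℕ) → ℤ
  earlyV d g N r₃ v r = τ (d + g) r₃ r (d + 0) g N v

  early : (d g N r₃ : ℕ) → ℤ
  early d g N r₃ = earlyC d g N r₃ ⊕ (Σ⁺⟨ N ⟩ (earlyW d g r₃) ⊕ Σ⁺⟨ d ⟩ (earlyV d g N r₃))

  lateW lateW⁺ lateV : (e p r w s : ℕ) → ℤ
  lateW  e p r w s = τ e r (s * 2 + (e + p)) (e + p) 0 w 0
  lateW⁺ e p r w s = τ e r (1 + s * 2 + (e + p)) (e + p) 0 w 0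
  lateV  e p r v s = τ e r s (e + p) 0 r v

  late : (e p r : ℕ) → ℤ
  late e p r = (Σ⟨ r ⟩ (lateW e p r) ⊕ Σ⁺⟨ r ⟩ (lateW⁺ e p r)) ⊕ Σ⁺⟨ e + p ⟩ (lateV e p r)

  grouped : (e N : ℕ) → ℤ
  grouped e N =
    (Σ⟨ e ⟩ (λ d g → early d g N (g * 2 + N))
      -- For a₂ = 2d - 1 the abscissa is one ahead, so both a₃ = 0 and a₃ = 1 need no further step.
      -- The single `τ` is a₃ = 0; `early` runs over a₃ - 1.
      ⊕ Σ⁺⟨ e ⟩ (λ d g → τ (d + g) (1 + g * 2 + N) (suc (g * 3 + (N * 2 + d))) (d + 0) 0 0 0
                            ⊕ early d g N (1 + g * 2 + N)))
    ⊕ Σ⁺⟨ N ⟩ (late e)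

  -- `b` is the bounce as a function of a₂, a₃, a₄. Keeping it abstract lets the vectors with four
  -- parts and, for k = 0, those with three share the regrouping.
  module _ (N : ℕ) (b : ℕ → ℕ → ℕ → ℕ) where

    val : (e a₂ r₃ a₃ r₄ : ℕ) → ℤ
    val e a₂ r₃ a₃ r₄ = ℓ (e + (r₃ + (r₄ + 0)) + A) (b a₂ a₃ (r₄ + (e + N)) + B)

    tail : (e a₂ r₃ : ℕ) → ℤ
    tail e a₂ r₃ = Σ⟨ r₃ + (e + N) ⟩ (val e a₂ r₃)

    module _ {e : ℕ} (spec : BounceSpec u e N b) where

      val-τ : ∀ {a₂ a₃ d p c w v} r₃ r₄ → Leg₁ e N a₂ d p →
        Leg₂ e N (d * 2 + p * 1) (d + p) (a₂ + a₃) c w v →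
        val e a₂ r₃ a₃ r₄ ≡ τ e r₃ r₄ (d + p) c w v
      val-τ r₃ r₄ leg₁ leg₂ = cong (λ z → ℓ (e + (r₃ + (r₄ + 0)) + A) (z + B)) (spec leg₁ leg₂)

    -- The offset `s` makes up for the overshoot: a₂ + s = 2d is the abscissa at which the third
    -- column starts, so both parities of a₂ lead to the same sum.
    early-legs : ∀ {d g a₂} r₃ s → BounceSpec u (d + g) N b → Leg₁ (d + g) N a₂ d 0 →
      (∀ a → a₂ + (s + a) ≡ d * 2 + 0 + a) →
      Σ⟨ g * 3 + (N * 2 + d) ⟩ (λ a r → val (d + g) a₂ r₃ (s + a) r) ≡ early d g N r₃
    early-legs {d} {g} {a₂} r₃ s spec leg₁ T≡ = trans (Σ-legs g N d _)
      (cong₂ _⊕_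
        (cong₂ _⊕_ (Σ-cong g c₀)
          (Σ⁺-cong g (λ c r eq → cong₂ _⊕_
            (v _ (leg₂-c c (T≡ _) (c≤ c r eq) (s≤s (ℕP.m≤n+m (c * 3) 1)) (ℕP.n≤1+n _)))
            (v _ (leg₂-c c (T≡ _) (c≤ c r eq) ℕP.≤-refl (ℕP.m≤n+m _ 2))))))
        (cong₂ _⊕_
          (Σ⁺-cong N (λ w r eq → cong₂ _⊕_
            (v _ (leg₂-w g w (T≡ _) g-speed ≤g (w≤ w r eq) (ℕP.+-monoʳ-< (g * 3) (s≤s (ℕP.m≤n+m _ 1))) ℕP.≤-refl))
            (v _ (leg₂-w g w (T≡ _) g-speed ≤g (w≤ w r eq) (ℕP.+-monoʳ-< (g * 3) ℕP.≤-refl) (ℕP.+-monoʳ-≤ (g * 3) (ℕP.n≤1+n _))))))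
          (Σ⁺-cong d (λ v′ r eq →
            v _ (leg₂-v g N (suc v′) (T≡ _) g-speed ≤g (lemma d g N) (v≤ (suc v′) r eq) refl)))))
      where
      v : ∀ {a c w v} r₄ → Leg₂ (d + g) N (d * 2 + 0) (d + 0) (a₂ + (s + a)) c w v →
        val (d + g) a₂ r₃ (s + a) r₄ ≡ τ (d + g) r₃ r₄ (d + 0) c w v
      v r₄ = val-τ spec r₃ r₄ leg₁
      c≤ : ∀ c r → suc c + r ≡ g → d + 0 + suc c ≤ d + g
      c≤ c r refl = subst (λ z → z + suc c ≤ d + (suc c + r)) (sym (ℕP.+-identityʳ d)) (ℕP.+-monoʳ-≤ d (ℕP.m≤m+n (suc c) r))
      c₀ : ∀ c r → c + r ≡ g → val (d + g) a₂ r₃ (s + c * 3) (r * 3 + (N * 2 + d)) ≡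
        τ (d + g) r₃ (r * 3 + (N * 2 + d)) (d + 0) c 0 0
      c₀ zero    r eq = v _ (leg₂-0 (ℕP.≤-reflexive (trans (T≡ 0) (ℕP.+-identityʳ _)))
        (subst (_≤ d + g + N) (sym (ℕP.+-identityʳ d)) (ℕP.≤-trans (ℕP.m≤m+n d g) (ℕP.m≤m+n _ N))))
      c₀ (suc c) r eq = v _ (leg₂-c c (T≡ _) (c≤ c r eq) (s≤s (ℕP.m≤n+m (c * 3) 2)) ℕP.≤-refl)
      d+0 : d ≡ d + 0
      d+0 = sym (ℕP.+-identityʳ d)
      g-speed : ∀ j → j < g → d + 0 + j < d + g
      g-speed j j< = subst (λ z → z + j < d + g) d+0 (ℕP.+-monoʳ-< d j<)
      ≤g : d + g ≤ d + 0 + g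
      ≤g = ℕP.≤-reflexive (cong (_+ g) d+0)
      lemma : ∀ d g N → d + 0 + (g + N) ≡ d + g + N
      lemma = ℕRing.solve-∀
      w≤ : ∀ w r → suc w + r ≡ N → d + 0 + (g + suc w) ≤ d + g + N
      w≤ w r refl = subst (_≤ d + g + (suc w + r)) (sym (lemma d g (suc w))) (ℕP.+-monoʳ-≤ (d + g) (ℕP.m≤m+n (suc w) r))
      v≤ : ∀ v r → v + r ≡ d → g + (N + v) ≤ d + g + N
      v≤ v r refl = subst (g + (N + v) ≤_) (lemma′ v r g N) (ℕP.m≤m+n _ r)
        where
        lemma′ : ∀ v r g N → g + (N + v) + r ≡ v + r + g + N
        lemma′ = ℕRing.solve-∀

    early-tail : ∀ d g → BounceSpec u (d + g) N b → tail (d + g) (d * 2) (g * 2 + N) ≡ early d g N (g * 2 + N)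
    early-tail d g spec =
      trans (cong (λ n → Σ⟨ n ⟩ (val (d + g) (d * 2) (g * 2 + N))) (index d g N))
            (early-legs {d} {g} (g * 2 + N) 0 spec (leg₁-d d g) (λ a → cong (_+ a) (sym (ℕP.+-identityʳ (d * 2)))))
      where
      index : ∀ d g N → g * 2 + N + (d + g + N) ≡ g * 3 + (N * 2 + d)
      index = ℕRing.solve-∀

    early-tail′ : ∀ d g → BounceSpec u (suc d + g) N b →
      tail (suc d + g) (suc (d * 2)) (1 + g * 2 + N) ≡
      τ (suc d + g) (1 + g * 2 + N) (suc (g * 3 + (N * 2 + suc d))) (suc d + 0) 0 0 0 ⊕ early (suc d) g N (1 + g * 2 + N)
    early-tail′ d g spec =
      trans (cong (λ n → Σ⟨ n ⟩ (val (suc d + g) (suc (d * 2)) (1 + g * 2 + N))) (index d g N))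
        (cong₂ _⊕_
          (val-τ spec (1 + g * 2 + N) _ (leg₁-d′ d g) (leg₂-0 reached bounded))
          (early-legs {suc d} {g} (1 + g * 2 + N) 1 spec (leg₁-d′ d g) (step d)))
      where
      index : ∀ d g N → 1 + g * 2 + N + (suc d + g + N) ≡ suc (g * 3 + (N * 2 + suc d))
      index = ℕRing.solve-∀
      step : ∀ d a → suc (d * 2) + suc a ≡ suc d * 2 + 0 + a
      step = ℕRing.solve-∀
      bounded : suc d + 0 ≤ suc d + g + N
      bounded = subst (_≤ suc d + g + N) (sym (ℕP.+-identityʳ (suc d))) (ℕP.≤-trans (ℕP.m≤m+n (suc d) g) (ℕP.m≤m+n _ N))
      reached : suc (d * 2) + 0 ≤ suc d * 2 + 0
      reached = s≤s (ℕP.n≤1+n _)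

  -- Because a₂ > 2e, the first column is exhausted before the third starts. Hence there is no step
  -- at speed 3, and a₂ is hit exactly, since it is approached at speed 1.
  late-tail : ∀ e p r b → BounceSpec u e (suc p + r) b →
    tail (suc p + r) b e (e * 2 + suc p) r ≡ late e (suc p) r
  late-tail e p′ r b spec =
    trans (cong (λ n → Σ⟨ n ⟩ (val (suc p′ + r) b e (e * 2 + p) r)) (index e p r))
      (trans (Σ-multiples r (e + p) _)
        (cong₂ _⊕_
          (cong₂ _⊕_
            (Σ-cong r w₀)
            (Σ⁺-cong r (λ w s eq → v _ (leg₂-w 0 w (T≡ _) (λ _ ()) e≤ (w≤ (suc w) s eq) ℕP.≤-refl (ℕP.n≤1+n _)))))
          (Σ⁺-cong (e + p) (λ v′ s eq → v _ (leg₂-v 0 r (suc v′) (T≡ _) (λ _ ()) e≤ (ℕP.+-assoc e p r) (v≤ (suc v′) s eq) refl)))))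
    where
    p : ℕ
    p = suc p′
    index : ∀ e p r → r + (e + (p + r)) ≡ r * 2 + (e + p)
    index = ℕRing.solve-∀
    v : ∀ {a c w v} r₄ → Leg₂ e (p + r) (e * 2 + p * 1) (e + p) (e * 2 + p + a) c w v →
        val (p + r) b e (e * 2 + p) r a r₄ ≡ τ e r r₄ (e + p) c w v
    v r₄ = val-τ (p + r) b spec r r₄ (leg₁-p e p r)
    T≡ : ∀ a → e * 2 + p + a ≡ e * 2 + p * 1 + a
    T≡ a = cong (λ z → e * 2 + z + a) (sym (ℕP.*-identityʳ p))
    e≤ : e ≤ e + p + 0
    e≤ = ℕP.≤-trans (ℕP.m≤m+n e p) (ℕP.m≤m+n _ 0)
    w≤ : ∀ w s → w + s ≡ r → e + p + w ≤ e + (p + r)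
    w≤ w s refl = subst (e + p + w ≤_) (ℕP.+-assoc e p (w + s)) (ℕP.+-monoʳ-≤ (e + p) (ℕP.m≤m+n w s))
    v≤ : ∀ v s → v + s ≡ e + p → r + v ≤ e + (p + r)
    v≤ v s eq = subst (r + v ≤_) (trans (cong (r +_) eq) (lemma e p r)) (ℕP.+-monoʳ-≤ r (ℕP.m≤m+n v s))
      where
      lemma : ∀ e p r → r + (e + p) ≡ e + (p + r)
      lemma = ℕRing.solve-∀
    w₀ : ∀ w s → w + s ≡ r → val (p + r) b e (e * 2 + p) r (w * 2) (s * 2 + (e + p)) ≡ τ e r (s * 2 + (e + p)) (e + p) 0 w 0
    w₀ zero    s eq = v _ (leg₂-0 (ℕP.≤-reflexive (trans (ℕP.+-identityʳ _) (cong (e * 2 +_) (sym (ℕP.*-identityʳ p)))))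
      (ℕP.+-monoʳ-≤ e (ℕP.m≤m+n p r)))
    w₀ (suc w) s eq = v _ (leg₂-w 0 w (T≡ _) (λ _ ()) e≤ (w≤ (suc w) s eq) (s≤s (ℕP.n≤1+n _)) ℕP.≤-refl)

  regroup : ∀ e N b → BounceSpec u e N b → Σ⟨ e + (e + N) ⟩ (tail N b e) ≡ grouped e N
  regroup e N b spec =
    trans (cong (λ n → Σ⟨ n ⟩ (tail N b e)) (index e N))
      (trans (Σ-multiples e N (tail N b e))
        (cong₂ _⊕_
          (cong₂ _⊕_ (Σ-cong e λ { d g refl → early-tail N b d g spec })
                     (Σ⁺-cong e λ { d g refl → early-tail′ N b d g spec }))
          (Σ⁺-cong N λ { p r refl → late-tail e p r b spec })))
    where
    index : ∀ e N → e + (e + N) ≡ e * 2 + N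
    index = ℕRing.solve-∀

-- Sums over Dyck paths

Σᴸ : List (List ℕ) → (List ℕ → ℤ) → ℤ
Σᴸ []       f = 0ℤ
Σᴸ (p ∷ ps) f = f p ⊕ Σᴸ ps f

Σᴸ-++ : ∀ ps qs f → Σᴸ (ps ++ qs) f ≡ Σᴸ ps f ⊕ Σᴸ qs f
Σᴸ-++ []       qs f = sym (ℤP.+-identityˡ _)
Σᴸ-++ (p ∷ ps) qs f = trans (cong (f p ⊕_) (Σᴸ-++ ps qs f)) (sym (ℤP.+-assoc (f p) _ _))

Σᴸ-map : ∀ h ps f → Σᴸ (map h ps) f ≡ Σᴸ ps (f ∘ h)
Σᴸ-map h []       f = refl
Σᴸ-map h (p ∷ ps) f = cong (f (h p) ⊕_) (Σᴸ-map h ps f)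

Σᴸ-applyUpTo : ∀ n (g : ℕ → List (List ℕ)) h f →
  Σᴸ (concatMap g (applyUpTo h (suc n))) f ≡ Σ⟨ n ⟩ (λ a r → Σᴸ (g (h a)) f)
Σᴸ-applyUpTo zero    g h f = cong (λ ps → Σᴸ ps f) (ListP.++-identityʳ (g (h 0)))
Σᴸ-applyUpTo (suc n) g h f =
  trans (Σᴸ-++ (g (h 0)) _ f) (cong (Σᴸ (g (h 0)) f ⊕_) (Σᴸ-applyUpTo n g (h ∘ suc) f))

dyckGen-∷ : ∀ r k ks f → Σᴸ (dyckGen r (k ∷ ks)) f ≡
  Σ⟨ r + k ⟩ (λ a r′ → Σᴸ (dyckGen r′ ks) (λ as → f (a ∷ as)))
dyckGen-∷ r k ks f =
  trans (Σᴸ-applyUpTo (r + k) (λ a → map (a ∷_) (dyckGen ((r + k) ∸ a) ks)) (λ a → a) f)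
        (Σ-cong (r + k) (λ a r′ eq → trans (Σᴸ-map (a ∷_) (dyckGen ((r + k) ∸ a) ks) f)
          (cong (λ r → Σᴸ (dyckGen r ks) (λ as → f (a ∷ as)))
                (trans (cong (_∸ a) (sym eq)) (ℕP.m+n∸m≡n a r′)))))

-- The path has to end at rank 0, so a single value of the last exponent survives.
dyckGen-[] : ∀ n g → Σ⟨ n ⟩ (λ a r → Σᴸ (dyckGen r []) (g a)) ≡ g n []
dyckGen-[] zero    g = ℤP.+-identityʳ _
dyckGen-[] (suc n) g = trans (ℤP.+-identityˡ _) (dyckGen-[] n (λ a → g (suc a)))

dyckGen₃ : ∀ e l f → Σᴸ (dyckGen e (l ∷ l ∷ l ∷ [])) f ≡
  Σ⟨ e + l ⟩ (λ a₂ r₃ → Σ⟨ r₃ + l ⟩ (λ a₃ r₄ → f (a₂ ∷ a₃ ∷ r₄ + l ∷ [])))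
dyckGen₃ e l f = trans (dyckGen-∷ e l (l ∷ l ∷ []) f) (Σ-cong (e + l) (λ a₂ r₃ _ →
  trans (dyckGen-∷ r₃ l (l ∷ []) _) (Σ-cong (r₃ + l) (λ a₃ r₄ _ →
    trans (dyckGen-∷ r₄ l [] _) (dyckGen-[] (r₄ + l) (λ a₄ as → f (a₂ ∷ a₃ ∷ a₄ ∷ as)))))))

areaFrom₃ : ∀ e l a₂ r₃ a₃ r₄ a₄ → a₂ + r₃ ≡ e + l → a₃ + r₄ ≡ r₃ + l →
  areaFrom e (l ∷ l ∷ l ∷ []) (a₂ ∷ a₃ ∷ a₄ ∷ []) ≡ e + (r₃ + (r₄ + 0))
areaFrom₃ e l a₂ r₃ a₃ r₄ a₄ eq eq′
  rewrite sym eq | ℕP.m+n∸m≡n a₂ r₃ | sym eq′ | ℕP.m+n∸m≡n a₃ r₄ = refl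

module _ (ℓ : ℕ → ℕ → ℤ) where

  weight : List ℕ → (A B : ℕ) → List ℕ → ℤ
  weight ks A B as = ℓ (area ks as + A) (bounce ks as + B)

  H : Series
  H k m A B = Σᴸ (dyckPaths (kVec k m)) (weight (kVec k m) A B)

  open Grouped ℓ

  dyckGen₃-grouped : ∀ u e N A B b → BounceSpec u e N b → ∀ f →
    (∀ a₂ a₃ a₄ → f (a₂ ∷ a₃ ∷ a₄ ∷ []) ≡
      ℓ (areaFrom e (e + N ∷ e + N ∷ e + N ∷ []) (a₂ ∷ a₃ ∷ a₄ ∷ []) + A) (b a₂ a₃ a₄ + B)) →
    Σᴸ (dyckGen e (e + N ∷ e + N ∷ e + N ∷ [])) f ≡ grouped u A B e N
  dyckGen₃-grouped u e N A B b spec f f≗ =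
    trans (dyckGen₃ e (e + N) f)
      (trans (Σ-cong (e + (e + N)) (λ a₂ r₃ eq → Σ-cong (r₃ + (e + N)) (λ a₃ r₄ eq′ →
                trans (f≗ a₂ a₃ (r₄ + (e + N)))
                      (cong (λ z → ℓ (z + A) (b a₂ a₃ (r₄ + (e + N)) + B))
                            (areaFrom₃ e (e + N) a₂ r₃ a₃ r₄ (r₄ + (e + N)) eq eq′)))))
             (regroup u A B e N b spec))

  H-grouped : H ≈ λ k m A B → Σ⟨ k ⟩ (λ u e → grouped u A B e (m + u))
  -- All ranges shrink to 0, and `grouped` evaluates to the weight of the empty path plus empty
  -- sums.
  H-grouped zero    zero    A B = lemma (ℓ A B)
    where
    lemma : ∀ x → x ⊕ 0ℤ ≡ ((((x ⊕ 0ℤ) ⊕ (0ℤ ⊕ 0ℤ)) ⊕ 0ℤ) ⊕ 0ℤ)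
    lemma = ℤRing.solve-∀
  H-grouped zero    (suc m) A B =
    trans (dyckGen₃-grouped 0 0 (suc m) A B _ (bounce₃ (suc m)) _ (λ _ _ _ → refl))
          (cong (grouped 0 A B 0) (sym (ℕP.+-identityʳ (suc m))))
  H-grouped (suc k) m A B =
    trans (dyckGen-∷ 0 (suc k) (l ∷ l ∷ l ∷ []) _)
      (Σ-cong (suc k) (λ u e eq → four (suc k) l u e (m + u) eq (height u e eq)))
    where
    l = suc k + m
    -- With a₁ = u the second north step starts at rank e = k - u, and N = m + u is what makes its
    -- length k + m equal to e + N.
    height : ∀ u e → u + e ≡ suc k → e + (m + u) ≡ l
    height u e eq = trans (lemma u e m) (cong (_+ m) eq)
      where
      lemma : ∀ u e m → e + (m + u) ≡ u + e + m
      lemma = ℕRing.solve-∀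
    four : ∀ k l u e N → u + e ≡ k → e + N ≡ l →
      Σᴸ (dyckGen e (l ∷ l ∷ l ∷ [])) (λ as → weight (k ∷ l ∷ l ∷ l ∷ []) A B (u ∷ as)) ≡ grouped u A B e N
    four k l u e N refl refl = dyckGen₃-grouped u e N A B _ (bounce₄ u e N) _ (λ a₂ a₃ a₄ →
      cong (λ r → ℓ (areaFrom r (e + N ∷ e + N ∷ e + N ∷ []) (a₂ ∷ a₃ ∷ a₄ ∷ []) + A)
                    (bounce (u + e ∷ e + N ∷ e + N ∷ e + N ∷ []) (u ∷ a₂ ∷ a₃ ∷ a₄ ∷ []) + B))
           (ℕP.m+n∸m≡n u e))

-- Matching the groups of paths with the cones

pos-pos : ∀ p n f → pos p (Σ⁺⟨ n ⟩ f) ≡ Σ⁺⟨ n ⟩ (λ u r → pos p (f u r))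
pos-pos zero    n f = sym (trans (Σ-cong n (λ { zero r _ → refl ; (suc u) r _ → refl })) (Σ-0 n))
pos-pos (suc p) n f = refl

Σ⁺-swap : ∀ n n′ (f : ℕ → ℕ → ℕ → ℕ → ℤ) →
  Σ⟨ n ⟩ (λ u r → Σ⁺⟨ n′ ⟩ (f u r)) ≡ Σ⁺⟨ n′ ⟩ (λ u′ r′ → Σ⟨ n ⟩ (λ u r → f u r u′ r′))
Σ⁺-swap n n′ f = trans (Σ-swap n n′ _) (Σ-cong n′ (λ u′ r′ _ → sym (pos-Σ u′ n _)))

Σ⁺-swap⁺ : ∀ n n′ (f : ℕ → ℕ → ℕ → ℕ → ℤ) →
  Σ⁺⟨ n ⟩ (λ u r → Σ⁺⟨ n′ ⟩ (f u r)) ≡ Σ⁺⟨ n′ ⟩ (λ u′ r′ → Σ⁺⟨ n ⟩ (λ u r → f u r u′ r′))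
Σ⁺-swap⁺ n n′ f = trans (Σ-cong n (λ u r _ → pos-pos u n′ (f u r))) (Σ⁺-swap n n′ _)

Σ⁺-assoc : ∀ n (f : ℕ → ℕ → ℕ → ℤ) →
  Σ⟨ n ⟩ (λ s c → Σ⁺⟨ s ⟩ (λ a b → f a b c)) ≡ Σ⁺⟨ n ⟩ (λ a s → Σ⟨ s ⟩ (f a))
Σ⁺-assoc n f = trans (Σ-assoc n _) (Σ-cong n (λ a s _ → sym (pos-Σ a s (f a))))

-- Needed when the outer generator of a cone belongs to only a part of u, d or p: that part is moved
-- to the outermost sum.
Σ⁺-reassoc : ∀ n {f} (g : ℕ → ℕ → ℕ → ℤ) →
  (∀ s c → s + c ≡ n → f s c ≡ Σ⁺⟨ s ⟩ (λ a b → g a b c)) → Σ⟨ n ⟩ f ≡ Σ⁺⟨ n ⟩ (λ a s → Σ⟨ s ⟩ (g a))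
Σ⁺-reassoc n g f≗ = trans (Σ-cong n f≗) (Σ⁺-assoc n g)

-- At s = 0 the inner positive sum is empty, so the outer guard excludes nothing.
Σ⁺-drop : ∀ n (f : ℕ → ℕ → ℕ → ℕ → ℤ) →
  Σ⁺⟨ n ⟩ (λ s c → Σ⁺⟨ s ⟩ (f s c)) ≡ Σ⟨ n ⟩ (λ s c → Σ⁺⟨ s ⟩ (f s c))
Σ⁺-drop n f = Σ-cong n (λ { zero c _ → refl ; (suc s) c _ → refl })

Σ-+₄ : ∀ n (f g h k : ℕ → ℕ → ℤ) →
  Σ⟨ n ⟩ (λ u r → f u r ⊕ ((g u r ⊕ h u r) ⊕ k u r)) ≡ Σ⟨ n ⟩ f ⊕ ((Σ⟨ n ⟩ g ⊕ Σ⟨ n ⟩ h) ⊕ Σ⟨ n ⟩ k)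
Σ-+₄ n f g h k =
  trans (Σ-+ n f _) (cong (Σ⟨ n ⟩ f ⊕_) (trans (Σ-+ n _ k) (cong (_⊕ Σ⟨ n ⟩ k) (Σ-+ n g h))))

Σ⁺-+₄ : ∀ n (f g h k : ℕ → ℕ → ℤ) →
  Σ⁺⟨ n ⟩ (λ u r → f u r ⊕ ((g u r ⊕ h u r) ⊕ k u r)) ≡ Σ⁺⟨ n ⟩ f ⊕ ((Σ⁺⟨ n ⟩ g ⊕ Σ⁺⟨ n ⟩ h) ⊕ Σ⁺⟨ n ⟩ k)
Σ⁺-+₄ n f g h k =
  trans (Σ⁺-+ n f _) (cong (Σ⁺⟨ n ⟩ f ⊕_) (trans (Σ⁺-+ n _ k) (cong (_⊕ Σ⁺⟨ n ⟩ k) (Σ⁺-+ n g h))))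

module Pieces (ℓ : ℕ → ℕ → ℤ) (m A B : ℕ) where

  private module G (u : ℕ) = Grouped ℓ u A B

  -- The parts of `grouped` before any change of summation order, lettered like the cones. The cuts
  -- come from splitting a range of length N = m + u after m: `fᵇ` and `fᶜ` differ in the side on
  -- which w lies, and `fᵉ`-`fʰ` from `fⁱ`-`fˡ` in the side on which p lies.
  fᵃ fᵇ fᶜ fᵈ fᵉ fᶠ fᵍ fʰ fⁱ fʲ fᵏ fˡ : (u e : ℕ) → ℤ
  fᵃ u e = Σ⟨ e ⟩ (λ d g → G.earlyC u d g (m + u) (g * 2 + (m + u)))
    ⊕ Σ⁺⟨ e ⟩ (λ d g → G.τ u (d + g) (1 + g * 2 + (m + u)) (suc (g * 3 + ((m + u) * 2 + d))) (d + 0) 0 0 0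
                         ⊕ G.earlyC u d g (m + u) (1 + g * 2 + (m + u)))
  fᵇ u e = Σ⟨ e ⟩ (λ d g → Σ⁺⟨ m ⟩ (λ w r → G.earlyW u d g (g * 2 + (m + u)) w (r + u)))
    ⊕ Σ⁺⟨ e ⟩ (λ d g → Σ⁺⟨ m ⟩ (λ w r → G.earlyW u d g (1 + g * 2 + (m + u)) w (r + u)))
  fᶜ u e = Σ⟨ e ⟩ (λ d g → Σ⁺⟨ u ⟩ (λ w r → G.earlyW u d g (g * 2 + (m + u)) (m + w) r))
    ⊕ Σ⁺⟨ e ⟩ (λ d g → Σ⁺⟨ u ⟩ (λ w r → G.earlyW u d g (1 + g * 2 + (m + u)) (m + w) r))
  fᵈ u e = Σ⟨ e ⟩ (λ d g → Σ⁺⟨ d ⟩ (G.earlyV u d g (m + u) (g * 2 + (m + u))))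
    ⊕ Σ⁺⟨ e ⟩ (λ d g → Σ⁺⟨ d ⟩ (G.earlyV u d g (m + u) (1 + g * 2 + (m + u))))
  fᵉ u e = Σ⁺⟨ m ⟩ (λ p s → Σ⟨ s ⟩ (λ w r → G.lateW u e p (s + u) w (r + u))
                             ⊕ Σ⁺⟨ s ⟩ (λ w r → G.lateW⁺ u e p (s + u) w (r + u)))
  fᶠ u e = Σ⁺⟨ m ⟩ (λ p s → Σ⁺⟨ u ⟩ (λ w r → G.lateW u e p (s + u) (s + w) r ⊕ G.lateW⁺ u e p (s + u) (s + w) r))
  fᵍ u e = Σ⁺⟨ m ⟩ (λ p s → Σ⁺⟨ p ⟩ (λ v r → G.lateV u e p (s + u) v (r + e)))
  fʰ u e = Σ⁺⟨ m ⟩ (λ p s → Σ⁺⟨ e ⟩ (λ v r → G.lateV u e p (s + u) (p + v) r))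
  fⁱ u e = Σ⁺⟨ u ⟩ (λ p s → Σ⟨ s ⟩ (G.lateW u e (m + p) s) ⊕ Σ⁺⟨ s ⟩ (G.lateW⁺ u e (m + p) s))
  fʲ u e = Σ⁺⟨ u ⟩ (λ p s → Σ⁺⟨ m ⟩ (λ v r → G.lateV u e (m + p) s v (r + p + e)))
  fᵏ u e = Σ⁺⟨ u ⟩ (λ p s → Σ⁺⟨ p ⟩ (λ v r → G.lateV u e (m + p) s (m + v) (r + e)))
  fˡ u e = Σ⁺⟨ u ⟩ (λ p s → Σ⁺⟨ e ⟩ (λ v r → G.lateV u e (m + p) s (m + p + v) r))

  grouped-early : ∀ u e → let N = m + u in
    Σ⟨ e ⟩ (λ d g → G.early u d g N (g * 2 + N))
      ⊕ Σ⁺⟨ e ⟩ (λ d g → G.τ u (d + g) (1 + g * 2 + N) (suc (g * 3 + (N * 2 + d))) (d + 0) 0 0 0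
                           ⊕ G.early u d g N (1 + g * 2 + N))
    ≡ fᵃ u e ⊕ ((fᵇ u e ⊕ fᶜ u e) ⊕ fᵈ u e)
  grouped-early u e = trans
    (cong₂ _⊕_
      (trans (Σ-cong e (λ d g _ → cong (λ z → C d g ⊕ (z ⊕ V d g)) (Σ⁺-split m u (G.earlyW u d g (g * 2 + N)))))
             (Σ-+₄ e C W₁ W₂ V))
      (trans (Σ-cong e (λ d g _ → cong (pos d) (trans
               (cong (λ z → Z d g ⊕ (C′ d g ⊕ (z ⊕ V′ d g))) (Σ⁺-split m u (G.earlyW u d g (1 + g * 2 + N))))
               (sym (ℤP.+-assoc (Z d g) (C′ d g) _)))))
             (Σ⁺-+₄ e (λ d g → Z d g ⊕ C′ d g) W₁′ W₂′ V′)))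
    (shuffle (Σ⟨ e ⟩ C) (Σ⟨ e ⟩ W₁) (Σ⟨ e ⟩ W₂) (Σ⟨ e ⟩ V)
             (Σ⁺⟨ e ⟩ (λ d g → Z d g ⊕ C′ d g)) (Σ⁺⟨ e ⟩ W₁′) (Σ⁺⟨ e ⟩ W₂′) (Σ⁺⟨ e ⟩ V′))
    where
    N = m + u
    Z C W₁ W₂ V C′ W₁′ W₂′ V′ : ℕ → ℕ → ℤ
    Z d g = G.τ u (d + g) (1 + g * 2 + N) (suc (g * 3 + (N * 2 + d))) (d + 0) 0 0 0
    C   d g = G.earlyC u d g N (g * 2 + N)
    C′  d g = G.earlyC u d g N (1 + g * 2 + N)
    W₁  d g = Σ⁺⟨ m ⟩ (λ w r → G.earlyW u d g (g * 2 + N) w (r + u))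
    W₁′ d g = Σ⁺⟨ m ⟩ (λ w r → G.earlyW u d g (1 + g * 2 + N) w (r + u))
    W₂  d g = Σ⁺⟨ u ⟩ (λ w r → G.earlyW u d g (g * 2 + N) (m + w) r)
    W₂′ d g = Σ⁺⟨ u ⟩ (λ w r → G.earlyW u d g (1 + g * 2 + N) (m + w) r)
    V   d g = Σ⁺⟨ d ⟩ (G.earlyV u d g N (g * 2 + N))
    V′  d g = Σ⁺⟨ d ⟩ (G.earlyV u d g N (1 + g * 2 + N))
    shuffle : ∀ a b c d a′ b′ c′ d′ → (a ⊕ ((b ⊕ c) ⊕ d)) ⊕ (a′ ⊕ ((b′ ⊕ c′) ⊕ d′)) ≡
      (a ⊕ a′) ⊕ (((b ⊕ b′) ⊕ (c ⊕ c′)) ⊕ (d ⊕ d′))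
    shuffle = ℤRing.solve-∀

  grouped-late₁ : ∀ u e → Σ⁺⟨ m ⟩ (λ p s → G.late u e p (s + u)) ≡ (fᵉ u e ⊕ fᶠ u e) ⊕ (fᵍ u e ⊕ fʰ u e)
  grouped-late₁ u e = trans
    (Σ-cong m (λ p s _ → cong (pos p) (cong₂ _⊕_
      (trans (cong₂ _⊕_ (Σ-split s u (G.lateW u e p (s + u))) (Σ⁺-split s u (G.lateW⁺ u e p (s + u))))
             (trans (+-interchange (Σ⟨ s ⟩ (λ w r → G.lateW u e p (s + u) w (r + u))) (Σ⁺⟨ u ⟩ (F₁ p s))
                                  (Σ⁺⟨ s ⟩ (λ w r → G.lateW⁺ u e p (s + u) w (r + u))) (Σ⁺⟨ u ⟩ (F₂ p s)))
                    (cong (E p s ⊕_) (sym (Σ⁺-+ u (F₁ p s) (F₂ p s))))))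
      (trans (cong (λ n → Σ⁺⟨ n ⟩ (G.lateV u e p (s + u))) (ℕP.+-comm e p)) (Σ⁺-split p e (G.lateV u e p (s + u)))))))
    (trans (Σ⁺-+ m (λ p s → E p s ⊕ F p s) (λ p s → V p s ⊕ V′ p s)) (cong₂ _⊕_ (Σ⁺-+ m E F) (Σ⁺-+ m V V′)))
    where
    E F V V′ : ℕ → ℕ → ℤ
    E p s = Σ⟨ s ⟩ (λ w r → G.lateW u e p (s + u) w (r + u)) ⊕ Σ⁺⟨ s ⟩ (λ w r → G.lateW⁺ u e p (s + u) w (r + u))
    F₁ F₂ : (p s w r : ℕ) → ℤ
    F₁ p s w r = G.lateW u e p (s + u) (s + w) r
    F₂ p s w r = G.lateW⁺ u e p (s + u) (s + w) r
    F p s = Σ⁺⟨ u ⟩ (λ w r → F₁ p s w r ⊕ F₂ p s w r)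
    V p s = Σ⁺⟨ p ⟩ (λ v r → G.lateV u e p (s + u) v (r + e))
    V′ p s = Σ⁺⟨ e ⟩ (λ v r → G.lateV u e p (s + u) (p + v) r)

  grouped-late₂ : ∀ u e → Σ⁺⟨ u ⟩ (λ p s → G.late u e (m + p) s) ≡ fⁱ u e ⊕ ((fʲ u e ⊕ fᵏ u e) ⊕ fˡ u e)
  grouped-late₂ u e = trans
    (Σ-cong u (λ p s _ → cong (pos p) (cong (I p s ⊕_)
      (trans (cong (λ n → Σ⁺⟨ n ⟩ (G.lateV u e (m + p) s)) (ℕP.+-comm e (m + p)))
        (trans (Σ⁺-split (m + p) e (G.lateV u e (m + p) s))
               (cong (_⊕ V₃ p s) (Σ⁺-split m p (λ v r → G.lateV u e (m + p) s v (r + e)))))))))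
    (Σ⁺-+₄ u I V₁ V₂ V₃)
    where
    I V₁ V₂ V₃ : ℕ → ℕ → ℤ
    I p s = Σ⟨ s ⟩ (G.lateW u e (m + p) s) ⊕ Σ⁺⟨ s ⟩ (G.lateW⁺ u e (m + p) s)
    V₁ p s = Σ⁺⟨ m ⟩ (λ v r → G.lateV u e (m + p) s v (r + p + e))
    V₂ p s = Σ⁺⟨ p ⟩ (λ v r → G.lateV u e (m + p) s (m + v) (r + e))
    V₃ p s = Σ⁺⟨ e ⟩ (λ v r → G.lateV u e (m + p) s (m + p + v) r)

  private
    Goal : (ℕ → ℕ → ℤ) → Expr → Set
    Goal f e = ∀ k → Σ⟨ k ⟩ f ≡ ⟦_⟧ ℓ e k m A B

  -- Here and for the other pieces, once the sums are nested as in the cone, matching on `refl`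
  -- replaces every total by the sum of its parts. Both exponents are then linear forms in free
  -- variables, which the semiring solver compares.
  piece-a : Goal fᵃ eᵃ
  piece-a k = Σ-cong k λ { u e refl → cong₂ _⊕_
    (Σ-cong e λ { d g refl → cong₂ _⊕_
      (Σ-cong g λ { c r refl → cong₂ ℓ (ℕRing.solve (u ∷ d ∷ c ∷ r ∷ m ∷ A ∷ [])) (ℕRing.solve (u ∷ d ∷ c ∷ r ∷ m ∷ B ∷ [])) })
      (Σ⁺-cong g λ { c r refl → cong₂ _⊕_
        (cong₂ ℓ (ℕRing.solve (u ∷ d ∷ c ∷ r ∷ m ∷ A ∷ [])) (ℕRing.solve (u ∷ d ∷ c ∷ r ∷ m ∷ B ∷ [])))
        (cong₂ ℓ (ℕRing.solve (u ∷ d ∷ c ∷ r ∷ m ∷ A ∷ [])) (ℕRing.solve (u ∷ d ∷ c ∷ r ∷ m ∷ B ∷ []))) }) })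
    (Σ⁺-cong e λ { d g refl → cong₂ _⊕_
      (cong₂ ℓ (ℕRing.solve (u ∷ d ∷ g ∷ m ∷ A ∷ [])) (ℕRing.solve (u ∷ d ∷ g ∷ m ∷ B ∷ [])))
      (cong₂ _⊕_
        (Σ-cong g λ { c r refl → cong₂ ℓ (ℕRing.solve (u ∷ d ∷ c ∷ r ∷ m ∷ A ∷ [])) (ℕRing.solve (u ∷ d ∷ c ∷ r ∷ m ∷ B ∷ [])) })
        (Σ⁺-cong g λ { c r refl → cong₂ _⊕_
          (cong₂ ℓ (ℕRing.solve (u ∷ d ∷ c ∷ r ∷ m ∷ A ∷ [])) (ℕRing.solve (u ∷ d ∷ c ∷ r ∷ m ∷ B ∷ [])))
          (cong₂ ℓ (ℕRing.solve (u ∷ d ∷ c ∷ r ∷ m ∷ A ∷ [])) (ℕRing.solve (u ∷ d ∷ c ∷ r ∷ m ∷ B ∷ []))) })) }) }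

  piece-b : Goal fᵇ eᵇ
  piece-b k = Σ-cong k λ { u e refl → cong₂ _⊕_
    (Σ-cong e λ { d g refl → Σ⁺-cong m λ { w r refl → cong₂ _⊕_
      (cong₂ ℓ (ℕRing.solve (u ∷ d ∷ g ∷ w ∷ r ∷ A ∷ [])) (ℕRing.solve (u ∷ d ∷ g ∷ w ∷ r ∷ B ∷ [])))
      (cong₂ ℓ (ℕRing.solve (u ∷ d ∷ g ∷ w ∷ r ∷ A ∷ [])) (ℕRing.solve (u ∷ d ∷ g ∷ w ∷ r ∷ B ∷ []))) } })
    (Σ⁺-cong e λ { d g refl → Σ⁺-cong m λ { w r refl → cong₂ _⊕_
      (cong₂ ℓ (ℕRing.solve (u ∷ d ∷ g ∷ w ∷ r ∷ A ∷ [])) (ℕRing.solve (u ∷ d ∷ g ∷ w ∷ r ∷ B ∷ [])))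
      (cong₂ ℓ (ℕRing.solve (u ∷ d ∷ g ∷ w ∷ r ∷ A ∷ [])) (ℕRing.solve (u ∷ d ∷ g ∷ w ∷ r ∷ B ∷ []))) } }) }

  piece-c : Goal fᶜ eᶜ
  piece-c k = Σ⁺-reassoc k (λ w r e → ⟦_⟧ ℓ (geo 𝐱 2 2 z ∔ geo⁺ 𝐱 2 2 (q· z)) e m (r * 3 + (w * 1 + A)) (r * 3 + (w * 4 + B))) (λ { u e refl → trans
      (cong₂ _⊕_ (Σ⁺-swap e u _) (Σ⁺-swap⁺ e u _))
      (trans (sym (Σ⁺-+ u _ _)) (Σ⁺-cong u λ { w r refl → cong₂ _⊕_
        (Σ-cong e λ { d g refl → cong₂ _⊕_
          (cong₂ ℓ (ℕRing.solve (m ∷ d ∷ g ∷ w ∷ r ∷ A ∷ [])) (ℕRing.solve (m ∷ d ∷ g ∷ w ∷ r ∷ B ∷ [])))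
          (cong₂ ℓ (ℕRing.solve (m ∷ d ∷ g ∷ w ∷ r ∷ A ∷ [])) (ℕRing.solve (m ∷ d ∷ g ∷ w ∷ r ∷ B ∷ []))) })
        (Σ⁺-cong e λ { d g refl → cong₂ _⊕_
          (cong₂ ℓ (ℕRing.solve (m ∷ d ∷ g ∷ w ∷ r ∷ A ∷ [])) (ℕRing.solve (m ∷ d ∷ g ∷ w ∷ r ∷ B ∷ [])))
          (cong₂ ℓ (ℕRing.solve (m ∷ d ∷ g ∷ w ∷ r ∷ A ∷ [])) (ℕRing.solve (m ∷ d ∷ g ∷ w ∷ r ∷ B ∷ []))) }) })) })
    where z = [1+q] (base 3 1 1 1)

  piece-d : Goal fᵈ eᵈ
  piece-d k = Σ-cong k λ { u e refl → trans
    (cong (Σ⟨ e ⟩ (λ d g → Σ⁺⟨ d ⟩ (G.earlyV u d g (m + u) (g * 2 + (m + u)))) ⊕_)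
          (Σ⁺-drop e (λ d g → G.earlyV u d g (m + u) (1 + g * 2 + (m + u)))))
    (trans (sym (Σ-+ e _ _))
      (Σ⁺-reassoc e (λ v r g → ⟦_⟧ ℓ ([1+q] (base 3 1 1 1)) g m (r * 2 + (v * 1 + (u * 1 + A))) (r * 2 + (v * 3 + (u * 4 + B)))) (λ { d g refl → trans (sym (Σ⁺-+ d _ _)) (Σ⁺-cong d λ { v r refl → cong₂ _⊕_
          (cong₂ ℓ (ℕRing.solve (m ∷ u ∷ g ∷ v ∷ r ∷ A ∷ [])) (ℕRing.solve (m ∷ u ∷ g ∷ v ∷ r ∷ B ∷ [])))
          (cong₂ ℓ (ℕRing.solve (m ∷ u ∷ g ∷ v ∷ r ∷ A ∷ [])) (ℕRing.solve (m ∷ u ∷ g ∷ v ∷ r ∷ B ∷ []))) }) }))) }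

  piece-e : Goal fᵉ eᵉ
  piece-e k = Σ-cong k λ { u e refl → Σ⁺-cong m λ { p s refl → cong₂ _⊕_
    (Σ-cong s λ { w r refl →
      cong₂ ℓ (ℕRing.solve (u ∷ e ∷ p ∷ w ∷ r ∷ A ∷ [])) (ℕRing.solve (u ∷ e ∷ p ∷ w ∷ r ∷ B ∷ [])) })
    (Σ⁺-cong s λ { w r refl →
      cong₂ ℓ (ℕRing.solve (u ∷ e ∷ p ∷ w ∷ r ∷ A ∷ [])) (ℕRing.solve (u ∷ e ∷ p ∷ w ∷ r ∷ B ∷ [])) }) } }

  piece-f : Goal fᶠ eᶠ
  piece-f k = Σ⁺-reassoc k (λ w r e → ⟦_⟧ ℓ (geo⁺ 𝐲 1 2 ([1+q] (base 2 2 1 1))) e m (r * 3 + (w * 1 + A)) (r * 3 + (w * 4 + B))) (λ { u e refl → trans (Σ⁺-swap⁺ m u _) (Σ⁺-cong u λ { w r refl → Σ⁺-cong m λ { p s refl → cong₂ _⊕_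
      (cong₂ ℓ (ℕRing.solve (e ∷ p ∷ s ∷ w ∷ r ∷ A ∷ [])) (ℕRing.solve (e ∷ p ∷ s ∷ w ∷ r ∷ B ∷ [])))
      (cong₂ ℓ (ℕRing.solve (e ∷ p ∷ s ∷ w ∷ r ∷ A ∷ [])) (ℕRing.solve (e ∷ p ∷ s ∷ w ∷ r ∷ B ∷ []))) } }) })

  piece-g : Goal fᵍ eᵍ
  piece-g k = Σ-cong k λ { u e refl → trans
    (Σ⁺-drop m (λ p s v r → G.lateV u e p (s + u) v (r + e)))
    (Σ⁺-reassoc m (λ v r s → ⟦_⟧ ℓ (base 2 2 1 1) e s (r * 1 + (v * 0 + (u * 1 + A))) (r * 2 + (v * 3 + (u * 4 + B)))) (λ { p s refl → Σ⁺-cong p λ { v r refl →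
        cong₂ ℓ (ℕRing.solve (u ∷ e ∷ s ∷ v ∷ r ∷ A ∷ [])) (ℕRing.solve (u ∷ e ∷ s ∷ v ∷ r ∷ B ∷ [])) } })) }

  piece-h : Goal fʰ eʰ
  piece-h k = Σ-cong k λ { u e refl → trans (Σ⁺-swap⁺ m e _)
    (Σ⁺-cong e λ { v r refl → Σ⁺-cong m λ { p s refl →
      cong₂ ℓ (ℕRing.solve (u ∷ p ∷ s ∷ v ∷ r ∷ A ∷ [])) (ℕRing.solve (u ∷ p ∷ s ∷ v ∷ r ∷ B ∷ [])) } }) }

  piece-i : Goal fⁱ eⁱ
  -- First p is taken out of u = p + w + r, then w out of w + r + e, so that r and e remain
  -- innermost as in `eⁱ`.
  piece-i k = trans
    (Σ⁺-reassoc k (λ p s e → Σ⟨ s ⟩ (λ w r → X p w r e) ⊕ Σ⁺⟨ s ⟩ (λ w r → X⁺ p w r e))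
      (λ { u e refl → Σ⁺-cong u λ { p s refl → cong₂ _⊕_
        (Σ-cong s λ { w r refl →
          cong₂ ℓ (ℕRing.solve (e ∷ m ∷ p ∷ w ∷ r ∷ A ∷ [])) (ℕRing.solve (e ∷ m ∷ p ∷ w ∷ r ∷ B ∷ [])) })
        (Σ⁺-cong s λ { w r refl →
          cong₂ ℓ (ℕRing.solve (e ∷ m ∷ p ∷ w ∷ r ∷ A ∷ [])) (ℕRing.solve (e ∷ m ∷ p ∷ w ∷ r ∷ B ∷ [])) }) } }))
    (Σ-cong k (λ p t _ → cong (pos p)
      (trans (Σ-+ t _ _) (cong₂ _⊕_ (Σ-assoc t (X p)) (Σ⁺-assoc t (X⁺ p))))))
    where
    X X⁺ : (p w r e : ℕ) → ℤ
    X  p w r e = ⟦_⟧ ℓ (base 2 2 1 2) e m (r * 3 + (w * 1 + (p * 1 + A))) (r * 3 + (w * 4 + (p * 5 + B)))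
    X⁺ p w r e = ⟦_⟧ ℓ (base 2 2 1 2) e m (r * 3 + (1 + (w * 1 + (p * 1 + A)))) (r * 3 + (w * 4 + (p * 5 + B)))

  piece-j : Goal fʲ eʲ
  piece-j k = Σ⁺-reassoc k (λ p s e → ⟦_⟧ ℓ (geo⁺ 𝐲 0 3 (base 2 2 1 2)) e m (s * 1 + (p * 1 + A)) (s * 4 + (p * 5 + B))) (λ { u e refl → Σ⁺-cong u λ { p s refl → Σ⁺-cong m λ { v r refl →
      cong₂ ℓ (ℕRing.solve (e ∷ p ∷ s ∷ v ∷ r ∷ A ∷ [])) (ℕRing.solve (e ∷ p ∷ s ∷ v ∷ r ∷ B ∷ [])) } } })

  piece-k : Goal fᵏ eᵏ
  piece-k k = trans
    (Σ⁺-reassoc k (λ v t e → Σ⟨ t ⟩ (λ r s → X v r s e))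
      (λ { u e refl → trans
        (Σ⁺-drop u (λ p s v r → G.lateV u e (m + p) s (m + v) (r + e)))
        (Σ⁺-reassoc u (λ v r s → X v r s e) (λ { p s refl → Σ⁺-cong p λ { v r refl →
          cong₂ ℓ (ℕRing.solve (e ∷ m ∷ s ∷ v ∷ r ∷ A ∷ [])) (ℕRing.solve (e ∷ m ∷ s ∷ v ∷ r ∷ B ∷ [])) } })) }))
    (Σ-cong k (λ v t _ → cong (pos v) (Σ-assoc t (X v))))
    where
    X : (v r s e : ℕ) → ℤ
    X v r s e = ⟦_⟧ ℓ (base 2 2 0 3) e m (s * 1 + (r * 1 + (v * 0 + A))) (s * 4 + (r * 5 + (v * 6 + B)))

  piece-l : Goal fˡ eˡ
  piece-l k = Σ⁺-reassoc k (λ p s e → ⟦_⟧ ℓ (geo⁺ 𝐱 1 3 (base 2 2 0 3)) e m (s * 1 + (p * 0 + A)) (s * 4 + (p * 6 + B))) (λ { u e refl → Σ⁺-cong u λ { p s refl → Σ⁺-cong e λ { v r refl →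
      cong₂ ℓ (ℕRing.solve (m ∷ p ∷ s ∷ v ∷ r ∷ A ∷ [])) (ℕRing.solve (m ∷ p ∷ s ∷ v ∷ r ∷ B ∷ [])) } } })

  Σ-⊕ : ∀ {f g} {F G : ℕ → ℤ} → (∀ k → Σ⟨ k ⟩ f ≡ F k) → (∀ k → Σ⟨ k ⟩ g ≡ G k) →
    ∀ k → Σ⟨ k ⟩ (λ u r → f u r ⊕ g u r) ≡ F k ⊕ G k
  Σ-⊕ {f} {g} p q k = trans (Σ-+ k f g) (cong₂ _⊕_ (p k) (q k))

  grouped-eᴴ : Goal (λ u e → G.grouped u e (m + u)) eᴴ
  grouped-eᴴ k = trans
    (Σ-cong k (λ u e _ → cong₂ _⊕_ (grouped-early u e)
      (trans (Σ⁺-split m u (G.late u e)) (cong₂ _⊕_ (grouped-late₁ u e) (grouped-late₂ u e)))))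
    (Σ-⊕ (Σ-⊕ piece-a (Σ-⊕ (Σ-⊕ piece-b piece-c) piece-d))
      (Σ-⊕ (Σ-⊕ (Σ-⊕ piece-e piece-f) (Σ-⊕ piece-g piece-h))
              (Σ-⊕ piece-i (Σ-⊕ (Σ-⊕ piece-j piece-k) piece-l))) k)

-- Clearing the common denominator

∇s-injective : ∀ gs F G → ∇s (mons gs) F ≈ ∇s (mons gs) G → F ≈ G
∇s-injective []                 F G eq = eq
∇s-injective ((a , α , β) ∷ gs) F G eq =
  ∇s-injective gs F G (∇-injective a α β {∇s (mons gs) F} {∇s (mons gs) G} eq)

∇s-++ : ∀ gs hs F → ∇s (gs ++ hs) F ≡ ∇s gs (∇s hs F)
∇s-++ []       hs F = refl
∇s-++ (g ∷ gs) hs F = cong (∇ g) (∇s-++ gs hs F)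

module _ (ℓ : ℕ → ℕ → ℤ) where

  H-eᴴ : H ℓ ≈ ⟦_⟧ ℓ eᴴ
  H-eᴴ k m A B = trans (H-grouped ℓ k m A B) (Pieces.grouped-eᴴ ℓ m A B k)

  ∇s-H : ∇s (mons denomGens) (H ℓ) ≈ numerator ▷ δ ℓ
  ∇s-H = ∇s-injective extraGens _ _ λ k m A B → begin
    ∇s (mons extraGens) (∇s (mons denomGens) (H ℓ)) k m A B
      ≡⟨ cong (λ F → F k m A B) (∇s-++ (mons extraGens) (mons denomGens) (H ℓ)) ⟨
    ∇s (mons extraGens ++ mons denomGens) (H ℓ) k m A B
      ≡⟨ ∇s-cong (mons extraGens ++ mons denomGens) H-eᴴ k m A B ⟩
    ∇s (mons extraGens ++ mons denomGens) (⟦_⟧ ℓ eᴴ) k m A B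
      ≡⟨ num-sound ℓ eᴴ (mons extraGens ++ mons denomGens) num-eᴴ k m A B ⟩
    (∇sᵖ (mons extraGens) numerator ▷ δ ℓ) k m A B
      ≡⟨ ∇sᵖ-▷ (mons extraGens) numerator (δ ℓ) k m A B ⟩
    ∇s (mons extraGens) (numerator ▷ δ ℓ) k m A B ∎
    where open ≡-Reasoning

  denom-H : denom ▷ H ℓ ≈ λ k m A B → ℤ.- (M ▷ δ ℓ) k m A B
  denom-H k m A B = begin
    (denom ▷ H ℓ) k m A B
      ≡⟨ sort-▷ denom (H ℓ) k m A B ⟨
    (sort denom ▷ H ℓ) k m A B
      ≡⟨ cong (λ P → (P ▷ H ℓ) k m A B) sort-denom ⟩
    (∇sᵖ (mons denomGens) one ▷ H ℓ) k m A B
      ≡⟨ ∇sᵖ-▷ (mons denomGens) one (H ℓ) k m A B ⟩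
    ∇s (mons denomGens) (one ▷ H ℓ) k m A B
      ≡⟨ ∇s-cong (mons denomGens) (one-▷ (H ℓ)) k m A B ⟩
    ∇s (mons denomGens) (H ℓ) k m A B
      ≡⟨ ∇s-H k m A B ⟩
    (numerator ▷ δ ℓ) k m A B
      ≡⟨ sort-▷ (scale -1ℤ (0 , 0 , 0 , 0) M) (δ ℓ) k m A B ⟩
    (scale -1ℤ (0 , 0 , 0 , 0) M ▷ δ ℓ) k m A B
      ≡⟨ scale-▷ -1ℤ (0 , 0 , 0 , 0) M (δ ℓ) k m A B ⟩
    -1ℤ ⊛ (M ▷ δ ℓ) k m A B
      ≡⟨ ℤP.-1*i≡-i _ ⟩
    ℤ.- (M ▷ δ ℓ) k m A B ∎
    where open ≡-Reasoning

-- Extracting coefficients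

<ᵇ-suc : ∀ m n → (m <ᵇ suc n) ≡ (m ≤ᵇ n)
<ᵇ-suc zero    n = refl
<ᵇ-suc (suc m) n = refl

shift-≤ᵇ : ∀ i f k → shift i f k ≡ (if i ≤ᵇ k then f (k ∸ i) else 0ℤ)
shift-≤ᵇ zero    f k       = refl
shift-≤ᵇ (suc i) f zero    = refl
shift-≤ᵇ (suc i) f (suc k) =
  trans (shift-≤ᵇ i f k) (cong (λ b → if b then f (k ∸ i) else 0ℤ) (sym (<ᵇ-suc i k)))

-- The test α ≤ a must be kept beside the subtraction, which truncates to 0 otherwise;
-- `polyTimesHCoeff` makes the same pair of tests. The form α + 0 is the exponent that `_∙_`
-- produces at `A` = 0.
≡ᵇ-∸ : ∀ α x a → (x + (α + 0) ≡ᵇ a) ≡ (α ≤ᵇ a) ∧ (x ≡ᵇ a ∸ α)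
≡ᵇ-∸ α x a = trans (cong (_≡ᵇ a) (trans (cong (x +_) (ℕP.+-identityʳ α)) (ℕP.+-comm x α))) (lemma α a)
  where
  lemma : ∀ α a → (α + x ≡ᵇ a) ≡ (α ≤ᵇ a) ∧ (x ≡ᵇ a ∸ α)
  lemma zero    a       = refl
  lemma (suc α) zero    = refl
  lemma (suc α) (suc a) = trans (lemma α a) (cong (_∧ (x ≡ᵇ a ∸ α)) (sym (<ᵇ-suc α a)))

module _ (a b : ℕ) where

  -- The choice of `ℓ` for the theorem: the coefficient of q^a t^b, given by its values on
  -- monomials.
  coeff : ℕ → ℕ → ℤ
  coeff A B = if (A ≡ᵇ a) ∧ (B ≡ᵇ b) then 1ℤ else 0ℤ

  private
    when : Bool → ℤ → ℤ
    when c z = if c then z else 0ℤ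

    when-0 : ∀ c → 0ℤ ≡ when c 0ℤ
    when-0 false = refl
    when-0 true  = refl

    when-+ : ∀ c x y → when c x ⊕ when c y ≡ when c (x ⊕ y)
    when-+ false x y = refl
    when-+ true  x y = refl

    regroupᵇ : ∀ c₁ d₁ c₂ d₂ → (if (c₁ ∧ d₁) ∧ (c₂ ∧ d₂) then 1ℤ else 0ℤ) ≡
      when (c₁ ∧ c₂) (ℤ.+ (if d₁ ∧ d₂ then 1 else 0))
    regroupᵇ false d₁    c₂    d₂    = refl
    regroupᵇ true  false false d₂    = refl
    regroupᵇ true  false true  d₂    = refl
    regroupᵇ true  true  false d₂    = refl
    regroupᵇ true  true  true  false = refl
    regroupᵇ true  true  true  true  = refl

  countPaths-Σᴸ : ∀ ks α β ps → Σᴸ ps (weight coeff ks (α + 0) (β + 0)) ≡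
    when ((α ≤ᵇ a) ∧ (β ≤ᵇ b)) (ℤ.+ countPaths ks (a ∸ α) (b ∸ β) ps)
  countPaths-Σᴸ ks α β []       = when-0 _
  countPaths-Σᴸ ks α β (p ∷ ps) = trans
    (cong₂ _⊕_
      (trans (cong₂ (λ c d → if c ∧ d then 1ℤ else 0ℤ) (≡ᵇ-∸ α (area ks p) a) (≡ᵇ-∸ β (bounce ks p) b))
             (regroupᵇ (α ≤ᵇ a) (area ks p ≡ᵇ a ∸ α) (β ≤ᵇ b) (bounce ks p ≡ᵇ b ∸ β)))
      (countPaths-Σᴸ ks α β ps))
    (when-+ ((α ≤ᵇ a) ∧ (β ≤ᵇ b)) _ _)

  polyTimesHCoeff-▷ : ∀ P k m → polyTimesHCoeff P k m a b ≡ (P ▷ H coeff) k m 0 0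
  polyTimesHCoeff-▷ []                          k m = refl
  polyTimesHCoeff-▷ ((c , (i , j , α , β)) ∷ P) k m = cong₂ _⊕_ (sym term) (polyTimesHCoeff-▷ P k m)
    where
    open ≡-Reasoning
    merge : ∀ b₁ b₂ b₃ z → c ⊛ when b₁ (when b₂ (when b₃ z)) ≡ when (b₁ ∧ b₂ ∧ b₃) (c ⊛ z)
    merge false b₂    b₃    z = ℤP.*-zeroʳ c
    merge true  false b₃    z = ℤP.*-zeroʳ c
    merge true  true  false z = ℤP.*-zeroʳ c
    merge true  true  true  z = refl
    term : c ⊛ ((i , j , α , β) ∙ H coeff) k m 0 0 ≡
      when ((i ≤ᵇ k) ∧ (j ≤ᵇ m) ∧ (α ≤ᵇ a) ∧ (β ≤ᵇ b)) (c ⊛ (ℤ.+ Hcoeff (k ∸ i) (m ∸ j) (a ∸ α) (b ∸ β)))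
    term = begin
      c ⊛ shift i (λ k′ → shift j (λ m′ → H coeff k′ m′ (α + 0) (β + 0)) m) k
        ≡⟨ cong (c ⊛_) (shift-≤ᵇ i _ k) ⟩
      c ⊛ when (i ≤ᵇ k) (shift j (λ m′ → H coeff (k ∸ i) m′ (α + 0) (β + 0)) m)
        ≡⟨ cong (λ z → c ⊛ when (i ≤ᵇ k) z) (shift-≤ᵇ j _ m) ⟩
      c ⊛ when (i ≤ᵇ k) (when (j ≤ᵇ m) (H coeff (k ∸ i) (m ∸ j) (α + 0) (β + 0)))
        ≡⟨ cong (λ z → c ⊛ when (i ≤ᵇ k) (when (j ≤ᵇ m) z))
             (countPaths-Σᴸ (kVec (k ∸ i) (m ∸ j)) α β (dyckPaths (kVec (k ∸ i) (m ∸ j)))) ⟩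
      c ⊛ when (i ≤ᵇ k) (when (j ≤ᵇ m) (when ((α ≤ᵇ a) ∧ (β ≤ᵇ b)) (ℤ.+ Hcoeff (k ∸ i) (m ∸ j) (a ∸ α) (b ∸ β))))
        ≡⟨ merge (i ≤ᵇ k) (j ≤ᵇ m) ((α ≤ᵇ a) ∧ (β ≤ᵇ b)) _ ⟩
      when ((i ≤ᵇ k) ∧ (j ≤ᵇ m) ∧ (α ≤ᵇ a) ∧ (β ≤ᵇ b)) (c ⊛ (ℤ.+ Hcoeff (k ∸ i) (m ∸ j) (a ∸ α) (b ∸ β))) ∎

  shift-δ : ∀ i j k m A B → shift i (λ k → shift j (λ m → δ coeff k m A B) m) k ≡
    when ((i ≡ᵇ k) ∧ (j ≡ᵇ m)) (coeff A B)
  shift-δ zero    zero    zero    zero    A B = refl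
  shift-δ zero    zero    zero    (suc m) A B = refl
  shift-δ zero    (suc j) zero    zero    A B = refl
  shift-δ zero    (suc j) zero    (suc m) A B = shift-δ zero j zero m A B
  shift-δ zero    j       (suc k) m       A B = shift-0 j m
  shift-δ (suc i) j       zero    m       A B = refl
  shift-δ (suc i) j       (suc k) m       A B = shift-δ i j k m A B

  polyCoeff-▷ : ∀ P k m → polyCoeff P k m a b ≡ (P ▷ δ coeff) k m 0 0
  polyCoeff-▷ []                          k m = refl
  polyCoeff-▷ ((c , (i , j , α , β)) ∷ P) k m = cong₂ _⊕_ (sym term) (polyCoeff-▷ P k m)
    where
    merge : ∀ b₁ b₂ b₃ → c ⊛ when (b₁ ∧ b₂) (if b₃ then 1ℤ else 0ℤ) ≡ when (b₁ ∧ b₂ ∧ b₃) c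
    merge false b₂    b₃    = ℤP.*-zeroʳ c
    merge true  false b₃    = ℤP.*-zeroʳ c
    merge true  true  false = ℤP.*-zeroʳ c
    merge true  true  true  = ℤP.*-identityʳ c
    term : c ⊛ ((i , j , α , β) ∙ δ coeff) k m 0 0 ≡ when ((i ≡ᵇ k) ∧ (j ≡ᵇ m) ∧ (α ≡ᵇ a) ∧ (β ≡ᵇ b)) c
    term = trans (cong (c ⊛_) (shift-δ i j k m (α + 0) (β + 0)))
      (trans (cong (λ z → c ⊛ when ((i ≡ᵇ k) ∧ (j ≡ᵇ m)) z)
               (cong₂ coeff (ℕP.+-identityʳ α) (ℕP.+-identityʳ β)))
             (merge (i ≡ᵇ k) (j ≡ᵇ m) ((α ≡ᵇ a) ∧ (β ≡ᵇ b))))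

theorem5p2 : ∀ (k m a b : ℕ) →
    polyTimesHCoeff denom k m a b ≡ - polyCoeff M k m a b
theorem5p2 k m a b = begin
  polyTimesHCoeff denom k m a b       ≡⟨ polyTimesHCoeff-▷ a b denom k m ⟩
  (denom ▷ H (coeff a b)) k m 0 0     ≡⟨ denom-H (coeff a b) k m 0 0 ⟩
  - (M ▷ δ (coeff a b)) k m 0 0       ≡⟨ cong -_ (polyCoeff-▷ a b M k m) ⟨
  - polyCoeff M k m a b               ∎
  where open ≡-Reasoning
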